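{- Let $t \ge 4$ be even and let $n \ge 4t + 16$ with $8 \mid n$. Let \[ S'_{t, n} = \{1, 2, \ldots, t-3 \} \cup \{ t-1, t \} \cup \left\{ \tfrac{n}{4}, \tfrac{n}{4} + 2 \right\} \cup \left\{ \tfrac{n}{2} - t, \tfrac{n}{2} - (t-1) \right\} \cup \left\{\tfrac{n}{2} - (t-3), \ldots, \tfrac{n}{2} - 2, \tfrac{n}{2} -1 \right\}. \] Then the circulant graph $\mathrm{Circ}(n, S'_{t, n})$ is a $4t$-regular circulant nut graph of order $n$.
   Context: For $n \ge 2$ and $S \subseteq \{1, 2, \ldots, \lfloor n/2 \rfloor\}$, $\mathrm{Circ}(n, S)$ denotes the simple graph on vertex set $\{0, 1, \ldots, n-1\}$ in which distinct vertices $i, j$ are adjacent if and only if $(j - i) \bmod n \in S$ or $(i - j) \bmod n \in S$ (so $S$ is its generator set). A nut graph is a graph with at least two vertices whose adjacency matrix has nullity exactly one and such that a nonzero vector spanning its null space has no zero entries; a circulant nut graph is a nut graph that is a circulant graph. -}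

module Defs where

open import Data.Nat using (ℕ; zero; suc; _+_; _*_; _∸_; _≤ᵇ_; _≡ᵇ_; _/_; _≤_)
open import Data.Bool using (Bool; true; false; _∧_; _∨_; not; if_then_else_; T)
open import Data.Bool.Properties using (T?)
open import Data.Fin using (Fin; toℕ)
open import Data.List using (List; length; filter; allFin)
open import Data.Rational using (ℚ; 0ℚ; 1ℚ) renaming (_+_ to _+ℚ_; _*_ to _*ℚ_)
open import Data.Product using (Σ; ∃; _×_)
open import Relation.Binary.PropositionalEquality using (_≡_; _≢_)

GenSet : Set
GenSet = ℕ → Bool

diffMod : (n : ℕ) → Fin n → Fin n → ℕ
diffMod n i j = if toℕ i ≤ᵇ toℕ j then toℕ j ∸ toℕ i else (toℕ j + n) ∸ toℕ i

circAdj : (n : ℕ) → GenSet → Fin n → Fin n → Bool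
circAdj n S i j = not (toℕ i ≡ᵇ toℕ j) ∧ (S (diffMod n i j) ∨ S (diffMod n j i))

degree : (n : ℕ) → GenSet → Fin n → ℕ
degree n S i = length (filter (λ j → T? (circAdj n S i j)) (allFin n))

IsRegular : (n : ℕ) → GenSet → ℕ → Set
IsRegular n S k = ∀ (i : Fin n) → degree n S i ≡ k

adjMatrix : (n : ℕ) → GenSet → Fin n → Fin n → ℚ
adjMatrix n S i j = if circAdj n S i j then 1ℚ else 0ℚ

sumFin : (n : ℕ) → (Fin n → ℚ) → ℚ
sumFin zero f = 0ℚ
sumFin (suc n) f = f Fin.zero +ℚ sumFin n (λ k → f (Fin.suc k))
  where import Data.Fin as Fin

InKernel : (n : ℕ) → (Fin n → Fin n → ℚ) → (Fin n → ℚ) → Set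
InKernel n A x = ∀ (i : Fin n) → sumFin n (λ j → A i j *ℚ x j) ≡ 0ℚ

SpansNullSpace : (n : ℕ) → (Fin n → Fin n → ℚ) → (Fin n → ℚ) → Set
SpansNullSpace n A x =
  (Σ (Fin n) λ i → x i ≢ 0ℚ) × InKernel n A x ×
  (∀ (y : Fin n → ℚ) → InKernel n A y → ∃ λ (c : ℚ) → ∀ (i : Fin n) → y i ≡ c *ℚ x i)

IsNutCirc : (n : ℕ) → GenSet → Set
IsNutCirc n S = 2 ≤ n × ∃ λ (x : Fin n → ℚ) →
  SpansNullSpace n (adjMatrix n S) x × (∀ (i : Fin n) → x i ≢ 0ℚ)

S′ : ℕ → ℕ → GenSet
S′ t n k =
  ((1 ≤ᵇ k) ∧ (k ≤ᵇ (t ∸ 3))) ∨ (k ≡ᵇ (t ∸ 1)) ∨ (k ≡ᵇ t) ∨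
  (k ≡ᵇ (n / 4)) ∨ (k ≡ᵇ ((n / 4) + 2)) ∨
  (k ≡ᵇ ((n / 2) ∸ t)) ∨ (k ≡ᵇ ((n / 2) ∸ (t ∸ 1))) ∨
  ((((n / 2) ∸ (t ∸ 3)) ≤ᵇ k) ∧ (k ≤ᵇ ((n / 2) ∸ 1)))

{-# OPTIONS --safe #-}
module Submission where

-- Extend null vectors to n-periodic integer sequences Z and let T be the shift.
-- Writing h = n/4, the part of Z on which T²ʰ = -1 satisfies T⁴ = 1 by the row
-- equation, so it vanishes because 4 divides 2h. On the rest T⁴ = 1 + 2C for an
-- integral C commuting with T, so T⁸ = 1 + 4D. As |4 D Z| ≤ 2 |Z|, D at least
-- halves the sup norm; it is therefore nilpotent on integer sequences, and
-- periodicity then forces D Z = 0, that is T⁸ = 1. Modulo T⁸ - 1, the row equation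
-- multiplied by T - 1 generates T² - 1 over ℚ, and for 2-periodic Z the row
-- equation says 2t (1 + T) Z = 0.

open import Defs
open import Algebra.Bundles using (AbelianGroup)
open import Data.Bool using (Bool; true; false; _∧_; _∨_; not; if_then_else_)
open import Data.Bool.Properties using (T?)
open import Data.Fin as Fin using (Fin; toℕ)
open import Data.Fin.Patterns
import Data.Fin.Properties as Fin
open import Data.Integer using (ℤ; +_; -[1+_]; 0ℤ; ∣_∣)
  renaming (_+_ to _+ℤ_; _*_ to _*ℤ_; _-_ to _-ℤ_; -_ to -ℤ_; NonZero to NonZeroℤ)
import Data.Integer.Properties as ℤ
import Data.Integer.Tactic.RingSolver as ℤ-Ring
open import Data.List using (List; []; _∷_; _++_; replicate; length; filter; tabulate)
open import Data.Nat
  using (ℕ; zero; suc; _+_; _*_; _∸_; _/_; _%_; _≤_; _<_; z≤n; s≤s; _≤ᵇ_; _≡ᵇ_; NonZero)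
open import Data.Nat.Divisibility using (_∣_; divides)
open import Data.Nat.DivMod
  using (m*n/n≡m; m≡m%n+[m/n]*n; m%n<n; m<n⇒m%n≡m; [m+n]%n≡m%n; _mod_; _divMod_; result)
import Data.Nat.Properties as ℕ
import Data.Nat.Tactic.RingSolver as ℕ-Ring
open import Data.Product using (_×_; _,_; ∃; proj₁; proj₂)
open import Data.Rational as Rational using (ℚ; mkℚ; 0ℚ; 1/_; ↥_)
  renaming (_+_ to _+ℚ_; _*_ to _*ℚ_)
open import Data.Rational.Literals using (fromℤ)
import Data.Rational.Properties as ℚ
import Data.Rational.Unnormalised as ℚᵘ
import Data.Rational.Unnormalised.Properties as ℚᵘ
open import Data.Sum using (_⊎_; inj₁; inj₂)
open import Relation.Binary.PropositionalEquality
  using (_≡_; _≢_; refl; sym; trans; cong; cong₂; subst; module ≡-Reasoning)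
open import Relation.Nullary using (contradiction; yes; no)
open import Relation.Nullary.Decidable using (dec-true; dec-false)

-- Over the complex numbers, the eigenvalues of T on null vectors are roots of unity, and the
-- descent is an elementary form of the fact that a root of unity congruent to 1 modulo 4 equals 1.
-- Modulus 2 would not do, since -1 ≡ 1 modulo 2; accordingly T⁴ = 1 + 2C only yields |C Z| ≤ |Z|,
-- and squaring provides the missing factor. The congruence T⁴ ≡ 1 modulo 2 comes from one
-- asymmetry: s ↦ n/2 - s preserves `S′` except that it sends n/4 + 2 to n/4 - 2. Where T^(n/2) = 1,
-- all terms of the row equation except those of this generator therefore get even coefficients.
-- Multiplication by T - 1 telescopes the runs of consecutive generators, so that t and n enter only
-- through exponents modulo 8; both t and n/4 are even, which leaves sixteen polynomials. The price
-- is an extra root T = 1, hence T² - 1 instead of T + 1; the value 2t (1 + T) on 2-periodic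
-- sequences removes it.

-- Sums over runs of consecutive indices.

window : (ℕ → ℤ) → ℕ → ℕ → ℤ
window f a zero    = 0ℤ
window f a (suc l) = f a +ℤ window f (suc a) l

window-cong : ∀ {f g} a b l → (∀ j → j < l → f (a + j) ≡ g (b + j)) →
  window f a l ≡ window g b l
window-cong a b zero eq = refl
window-cong {f} {g} a b (suc l) eq = cong₂ _+ℤ_
  (trans (cong f (sym (ℕ.+-identityʳ a)))
    (trans (eq 0 (s≤s z≤n)) (cong g (ℕ.+-identityʳ b))))
  (window-cong (suc a) (suc b) l λ j j<l →
    trans (cong f (sym (ℕ.+-suc a j)))
      (trans (eq (suc j) (s≤s j<l)) (cong g (ℕ.+-suc b j))))

window-++ : ∀ f a l m → window f a (l + m) ≡ window f a l +ℤ window f (a + l) m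
window-++ f a zero m =
  trans (cong (λ b → window f b m) (sym (ℕ.+-identityʳ a))) (sym (ℤ.+-identityˡ _))
window-++ f a (suc l) m = begin
  f a +ℤ window f (suc a) (l + m)
    ≡⟨ cong (f a +ℤ_) (window-++ f (suc a) l m) ⟩
  f a +ℤ (window f (suc a) l +ℤ window f (suc a + l) m)
    ≡⟨ ℤ.+-assoc (f a) _ _ ⟨
  f a +ℤ window f (suc a) l +ℤ window f (suc a + l) m
    ≡⟨ cong (λ b → f a +ℤ window f (suc a) l +ℤ window f b m) (ℕ.+-suc a l) ⟨
  f a +ℤ window f (suc a) l +ℤ window f (a + suc l) m ∎
  where open ≡-Reasoning

window-snoc : ∀ f a l → window f a (suc l) ≡ window f a l +ℤ f (a + l)
window-snoc f a l = begin
  window f a (suc l)                       ≡⟨ cong (window f a) (ℕ.+-comm 1 l) ⟩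
  window f a (l + 1)                       ≡⟨ window-++ f a l 1 ⟩
  window f a l +ℤ (f (a + l) +ℤ 0ℤ)        ≡⟨ cong (window f a l +ℤ_) (ℤ.+-identityʳ _) ⟩
  window f a l +ℤ f (a + l)                ∎
  where open ≡-Reasoning

-- The runs are traversed in opposite directions; `suc (i + j) ≡ l` pairs mirror positions without
-- truncated subtraction.
window-reverse : ∀ {f g} a b l → (∀ i j → suc (i + j) ≡ l → f (a + i) ≡ g (b + j)) →
  window f a l ≡ window g b l
window-reverse a b zero eq = refl
window-reverse {f} {g} a b (suc l) eq = begin
  f a +ℤ window f (suc a) l
    ≡⟨ cong₂ _+ℤ_ (trans (cong f (sym (ℕ.+-identityʳ a))) (eq 0 l refl))
         (window-reverse (suc a) b l λ i j e →
           trans (cong f (sym (ℕ.+-suc a i))) (eq (suc i) j (cong suc e))) ⟩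
  g (b + l) +ℤ window g b l  ≡⟨ ℤ.+-comm (g (b + l)) _ ⟩
  window g b l +ℤ g (b + l)  ≡⟨ window-snoc g b l ⟨
  window g b (suc l)         ∎
  where open ≡-Reasoning

window-zero : ∀ {f} a l → (∀ j → j < l → f (a + j) ≡ 0ℤ) → window f a l ≡ 0ℤ
window-zero a l eq = trans (window-cong a a l eq) (zeros a l)
  where
  zeros : ∀ a l → window (λ _ → 0ℤ) a l ≡ 0ℤ
  zeros a zero    = refl
  zeros a (suc l) = trans (ℤ.+-identityˡ _) (zeros (suc a) l)

-- Stating linearity as closure under relations x f = y g + z h lets the same
-- lemma cover sums, differences and halving.
LinRel : (x y z : ℤ) (f g h : ℕ → ℤ) → Set
LinRel x y z f g h = ∀ k → x *ℤ f k ≡ y *ℤ g k +ℤ z *ℤ h k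

lin-+ : ∀ {x y z p q r p′ q′ r′} →
  x *ℤ p ≡ y *ℤ q +ℤ z *ℤ r → x *ℤ p′ ≡ y *ℤ q′ +ℤ z *ℤ r′ →
  x *ℤ (p +ℤ p′) ≡ y *ℤ (q +ℤ q′) +ℤ z *ℤ (r +ℤ r′)
lin-+ {x} {y} {z} {p} {q} {r} {p′} {q′} {r′} e e′ = begin
  x *ℤ (p +ℤ p′)                                   ≡⟨ ℤ.*-distribˡ-+ x p p′ ⟩
  x *ℤ p +ℤ x *ℤ p′                                ≡⟨ cong₂ _+ℤ_ e e′ ⟩
  y *ℤ q +ℤ z *ℤ r +ℤ (y *ℤ q′ +ℤ z *ℤ r′)         ≡⟨ regroup y z q r q′ r′ ⟩
  y *ℤ (q +ℤ q′) +ℤ z *ℤ (r +ℤ r′)                 ∎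
  where
  open ≡-Reasoning
  regroup : ∀ y z q r q′ r′ → y *ℤ q +ℤ z *ℤ r +ℤ (y *ℤ q′ +ℤ z *ℤ r′)
    ≡ y *ℤ (q +ℤ q′) +ℤ z *ℤ (r +ℤ r′)
  regroup = ℤ-Ring.solve-∀

lin-0 : ∀ x y z → x *ℤ 0ℤ ≡ y *ℤ 0ℤ +ℤ z *ℤ 0ℤ
lin-0 = ℤ-Ring.solve-∀

window-lin : ∀ {x y z f g h} → LinRel x y z f g h → ∀ a l →
  x *ℤ window f a l ≡ y *ℤ window g a l +ℤ z *ℤ window h a l
window-lin {x} {y} {z} rel a zero    = lin-0 x y z
window-lin {x} {y} {z} rel a (suc l) =
  lin-+ {x} {y} {z} (rel a) (window-lin {x} {y} {z} rel (suc a) l)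

window-+ : ∀ f g a l → window (λ k → f k +ℤ g k) a l ≡ window f a l +ℤ window g a l
window-+ f g a zero    = refl
window-+ f g a (suc l) =
  trans (cong (f a +ℤ g a +ℤ_) (window-+ f g (suc a) l)) (interchange (f a) (g a) _ _)
  where
  interchange : ∀ p q r s → p +ℤ q +ℤ (r +ℤ s) ≡ p +ℤ r +ℤ (q +ℤ s)
  interchange = ℤ-Ring.solve-∀

-- This is what makes T - 1 useful: a run of any length contributes only its two ends.
window-telescope : ∀ f a l → window f (suc a) l -ℤ window f a l ≡ f (a + l) -ℤ f a
window-telescope f a l = begin
  window f (suc a) l -ℤ window f a l
    ≡⟨ add-sub (f a) _ _ ⟩
  window f a (suc l) -ℤ window f a l -ℤ f a
    ≡⟨ cong (λ w → w -ℤ window f a l -ℤ f a) (window-snoc f a l) ⟩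
  window f a l +ℤ f (a + l) -ℤ window f a l -ℤ f a
    ≡⟨ cancel (window f a l) (f (a + l)) (f a) ⟩
  f (a + l) -ℤ f a ∎
  where
  open ≡-Reasoning
  add-sub : ∀ p q r → q -ℤ r ≡ p +ℤ q -ℤ r -ℤ p
  add-sub = ℤ-Ring.solve-∀
  cancel : ∀ p q r → p +ℤ q -ℤ p -ℤ r ≡ q -ℤ r
  cancel = ℤ-Ring.solve-∀

-- Generator sets as disjoint unions of intervals.

gate : Bool → ℤ → ℤ
gate b x = if b then x else 0ℤ

-- The three cases match the cut of a long sum at `a` and `a + l`, so each piece is evaluated by one
-- field.
record Block (p : ℕ → Bool) (a l : ℕ) : Set where
  field
    below  : ∀ {k} → k < a → p k ≡ false
    inside : ∀ {k} → a ≤ k → k < a + l → p k ≡ true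
    above  : ∀ {k} → a + l ≤ k → p k ≡ false

window-block : ∀ {p a l} n f → Block p a l → a + l ≤ n →
  window (λ k → gate (p k) (f k)) 0 n ≡ window f a l
window-block {p} {a} {l} n f blk a+l≤n = begin
  window g 0 n
    ≡⟨ cong (window g 0) (trans (sym (ℕ.m+[n∸m]≡n a+l≤n)) (ℕ.+-assoc a l _)) ⟩
  window g 0 (a + (l + (n ∸ (a + l))))
    ≡⟨ window-++ g 0 a _ ⟩
  window g 0 a +ℤ window g a (l + (n ∸ (a + l)))
    ≡⟨ cong₂ _+ℤ_ (window-zero {g} 0 a λ j j<a → cong (λ b → gate b (f j)) (below j<a))
         (window-++ g a l _) ⟩
  0ℤ +ℤ (window g a l +ℤ window g (a + l) (n ∸ (a + l)))
    ≡⟨ ℤ.+-identityˡ _ ⟩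
  window g a l +ℤ window g (a + l) (n ∸ (a + l))
    ≡⟨ cong₂ _+ℤ_
         (window-cong {g} {f} a a l λ j j<l →
           cong (λ b → gate b (f (a + j))) (inside (ℕ.m≤m+n a j) (ℕ.+-monoʳ-< a j<l)))
         (window-zero {g} (a + l) (n ∸ (a + l)) λ j _ →
           cong (λ b → gate b (f (a + l + j))) (above (ℕ.m≤m+n (a + l) j))) ⟩
  window f a l +ℤ 0ℤ
    ≡⟨ ℤ.+-identityʳ _ ⟩
  window f a l ∎
  where
  open ≡-Reasoning
  open Block blk
  g : ℕ → ℤ
  g k = gate (p k) (f k)

Segments : Set
Segments = List (ℕ × ℕ)

segSum : Segments → (ℕ → ℤ) → ℤ
segSum []               f = 0ℤ
segSum ((a , l) ∷ segs) f = window f a l +ℤ segSum segs f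

segSum-cong : ∀ segs {f g} → (∀ k → f k ≡ g k) → segSum segs f ≡ segSum segs g
segSum-cong []               eq = refl
segSum-cong ((a , l) ∷ segs) eq =
  cong₂ _+ℤ_ (window-cong a a l λ j _ → eq (a + j)) (segSum-cong segs eq)

segSum-lin : ∀ {x y z f g h} segs → LinRel x y z f g h →
  x *ℤ segSum segs f ≡ y *ℤ segSum segs g +ℤ z *ℤ segSum segs h
segSum-lin {x} {y} {z} []               rel = lin-0 x y z
segSum-lin {x} {y} {z} ((a , l) ∷ segs) rel =
  lin-+ {x} {y} {z} (window-lin {x} {y} {z} rel a l) (segSum-lin {x} {y} {z} segs rel)

-- The right-nested disjunction follows the shape of `S′`. The order condition `a + l ≤ b` makes the
-- blocks disjoint, so the sum over their union is the plain sum over the segments.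
data Tiles (n : ℕ) : (ℕ → Bool) → Segments → Set where
  last : ∀ {p a l} → Block p a l → a + l ≤ n → Tiles n p ((a , l) ∷ [])
  cons : ∀ {p q a l b m segs} → Block p a l → a + l ≤ b →
         Tiles n q ((b , m) ∷ segs) →
         Tiles n (λ k → p k ∨ q k) ((a , l) ∷ (b , m) ∷ segs)

tiles-below : ∀ {n p a l segs k} → Tiles n p ((a , l) ∷ segs) → k < a → p k ≡ false
tiles-below (last blk _)        k<a = Block.below blk k<a
tiles-below (cons blk a+l≤b ts)  k<a = cong₂ _∨_ (Block.below blk k<a)
  (tiles-below ts (ℕ.<-≤-trans k<a (ℕ.≤-trans (ℕ.m≤m+n _ _) a+l≤b)))

tiles-fits : ∀ {n p a l segs} → Tiles n p ((a , l) ∷ segs) → a + l ≤ n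
tiles-fits (last _ fits)       = fits
tiles-fits (cons _ a+l≤b ts) =
  ℕ.≤-trans a+l≤b (ℕ.≤-trans (ℕ.m≤m+n _ _) (tiles-fits ts))

tiles-above : ∀ {n p segs k} → Tiles n p segs → n ≤ k → p k ≡ false
tiles-above (last blk fits) n≤k = Block.above blk (ℕ.≤-trans fits n≤k)
tiles-above (cons blk a+l≤b ts) n≤k = cong₂ _∨_
  (Block.above blk (ℕ.≤-trans (ℕ.≤-trans a+l≤b (ℕ.≤-trans (ℕ.m≤m+n _ _) (tiles-fits ts))) n≤k))
  (tiles-above ts n≤k)

gate-∨ : ∀ b c x → (b ≡ true → c ≡ false) → gate (b ∨ c) x ≡ gate b x +ℤ gate c x
gate-∨ true  c x excl rewrite excl refl = sym (ℤ.+-identityʳ x)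
gate-∨ false c x excl = sym (ℤ.+-identityˡ _)

window-tiles : ∀ {n N p segs} f → Tiles N p segs → N ≤ n →
  window (λ k → gate (p k) (f k)) 0 n ≡ segSum segs f
window-tiles {n} f (last blk fits) N≤n =
  trans (window-block n f blk (ℕ.≤-trans fits N≤n)) (sym (ℤ.+-identityʳ _))
window-tiles {n} f (cons {p} {q} {a} {l} {b} {m} {segs} blk a+l≤b ts) N≤n = begin
  window (λ k → gate (p k ∨ q k) (f k)) 0 n
    ≡⟨ window-cong 0 0 n (λ k _ → gate-∨ (p k) (q k) (f k) (exclusive k)) ⟩
  window (λ k → gate (p k) (f k) +ℤ gate (q k) (f k)) 0 n
    ≡⟨ window-+ (λ k → gate (p k) (f k)) (λ k → gate (q k) (f k)) 0 n ⟩
  window (λ k → gate (p k) (f k)) 0 n +ℤ window (λ k → gate (q k) (f k)) 0 n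
    ≡⟨ cong₂ _+ℤ_
         (window-block n f blk (ℕ.≤-trans a+l≤b
           (ℕ.≤-trans (ℕ.m≤m+n b _) (ℕ.≤-trans (tiles-fits ts) N≤n))))
         (window-tiles f ts N≤n) ⟩
  window f a l +ℤ segSum ((b , m) ∷ segs) f ∎
  where
  open ≡-Reasoning
  exclusive : ∀ k → p k ≡ true → q k ≡ false
  exclusive k pk with k ℕ.<? b
  ... | yes k<b = tiles-below ts k<b
  ... | no  k≮b =
    contradiction (trans (sym pk) (Block.above blk (ℕ.≤-trans a+l≤b (ℕ.≮⇒≥ k≮b)))) λ ()

-- Rows of a circulant adjacency matrix.

≤ᵇ-true : ∀ {a b} → a ≤ b → (a ≤ᵇ b) ≡ true
≤ᵇ-true {a} {b} = dec-true (a ℕ.≤? b)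

≤ᵇ-false : ∀ {a b} → b < a → (a ≤ᵇ b) ≡ false
≤ᵇ-false {a} {b} b<a = dec-false (a ℕ.≤? b) (ℕ.<⇒≱ b<a)

≡ᵇ-true : ∀ {a b} → a ≡ b → (a ≡ᵇ b) ≡ true
≡ᵇ-true {a} {b} = dec-true (a ℕ.≟ b)

≡ᵇ-false : ∀ {a b} → a ≢ b → (a ≡ᵇ b) ≡ false
≡ᵇ-false {a} {b} = dec-false (a ℕ.≟ b)

diffModℕ : ℕ → ℕ → ℕ → ℕ
diffModℕ n i j = if i ≤ᵇ j then j ∸ i else (j + n) ∸ i

circAdjℕ : ℕ → GenSet → ℕ → ℕ → Bool
circAdjℕ n S i j = not (i ≡ᵇ j) ∧ (S (diffModℕ n i j) ∨ S (diffModℕ n j i))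

diffMod-≤ : ∀ {n i j} → i ≤ j → diffModℕ n i j ≡ j ∸ i
diffMod-≤ i≤j rewrite ≤ᵇ-true i≤j = refl

diffMod-> : ∀ {n i j} → j < i → diffModℕ n i j ≡ (j + n) ∸ i
diffMod-> j<i rewrite ≤ᵇ-false j<i = refl

Periodic : ℕ → (ℕ → ℤ) → Set
Periodic p Z = ∀ k → Z (p + k) ≡ Z k

row : Segments → ℕ → (ℕ → ℤ) → ℕ → ℤ
row segs n Z k =
  segSum segs (λ d → Z (k + d)) +ℤ segSum segs (λ d → Z (k + (n ∸ d)))

-- The map d ↦ n - d permutes 1, ..., n - 1 but sends 0 to n; the two hypotheses on `S` make the
-- terms at 0 vanish on both sides.
window-mirror : ∀ n (S : GenSet) (f : ℕ → ℤ) → S 0 ≡ false → S n ≡ false →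
  window (λ d → gate (S (n ∸ d)) (f d)) 0 n ≡ window (λ d → gate (S d) (f (n ∸ d))) 0 n
window-mirror zero    S f _ _ = refl
window-mirror (suc m) S f S0≡false Sn≡false rewrite S0≡false | Sn≡false =
  cong (0ℤ +ℤ_) (window-reverse 1 1 m λ i j e → cong₂ (λ p q → gate (S p) (f q))
    (trans (cong (_∸ i) (trans (sym e) (ℕ.+-comm (suc i) j)))
      (trans (cong (_∸ i) (ℕ.+-suc j i)) (ℕ.m+n∸n≡m (suc j) i)))
    (sym (trans (cong (_∸ j) (sym e)) (ℕ.m+n∸n≡m (suc i) j))))

module _ {n N : ℕ} {S : GenSet} {a l : ℕ} {segs : Segments}
         (tiles : Tiles N S ((suc a , l) ∷ segs)) (N+N≤n : N + N ≤ n) where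

  private
    N≤n : N ≤ n
    N≤n = ℕ.≤-trans (ℕ.m≤m+n N N) N+N≤n

    S0≡false : S 0 ≡ false
    S0≡false = tiles-below tiles (s≤s z≤n)

    Sn≡false : S n ≡ false
    Sn≡false = tiles-above tiles N≤n

    -- Generators lie strictly below N ≤ n/2, so d and n - d are never both generators and no
    -- neighbour is counted twice.
    exclusive : ∀ d → S d ≡ true → S (n ∸ d) ≡ false
    exclusive d Sd with d ℕ.<? N
    ... | yes d<N = tiles-above tiles
      (ℕ.≤-trans (ℕ.m+n≤o⇒m≤o∸n N N+N≤n) (ℕ.∸-monoʳ-≤ n (ℕ.<⇒≤ d<N)))
    ... | no  d≮N = contradiction (trans (sym Sd) (tiles-above tiles (ℕ.≮⇒≥ d≮N))) λ ()

  gate-adj : ∀ {i j} d x → i ≢ j → diffModℕ n i j ≡ d → diffModℕ n j i ≡ n ∸ d →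
    gate (circAdjℕ n S i j) x ≡ gate (S d) x +ℤ gate (S (n ∸ d)) x
  gate-adj d x i≢j refl eq rewrite ≡ᵇ-false i≢j | eq =
    gate-∨ (S d) (S (n ∸ d)) x (exclusive d)

  gate-adj-ahead : ∀ i d x → i + d < n →
    gate (circAdjℕ n S i (i + d)) x ≡ gate (S d) x +ℤ gate (S (n ∸ d)) x
  gate-adj-ahead i zero x _
    rewrite ≡ᵇ-true {i} {i + 0} (sym (ℕ.+-identityʳ i)) | S0≡false | Sn≡false = refl
  gate-adj-ahead i d@(suc d-1) x _ = gate-adj d x
    (λ e → ℕ.m≢1+m+n i (trans e (ℕ.+-suc i d-1)))
    (trans (diffMod-≤ {n} (ℕ.m≤m+n i d)) (ℕ.m+n∸m≡n i d))
    (trans (diffMod-> (ℕ.m<m+n i (s≤s z≤n))) (ℕ.[m+n]∸[m+o]≡n∸o i n d))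

  gate-adj-behind : ∀ {i} j x → j < i → i < n →
    gate (circAdjℕ n S i j) x ≡
      gate (S (n ∸ i + j)) x +ℤ gate (S (n ∸ (n ∸ i + j))) x
  gate-adj-behind {i} j x j<i i<n = gate-adj (n ∸ i + j) x
    (λ e → ℕ.<-irrefl (sym e) j<i)
    (trans (diffMod-> j<i)
      (trans (ℕ.+-∸-assoc j i≤n) (ℕ.+-comm j (n ∸ i))))
    (trans (diffMod-≤ {n} (ℕ.<⇒≤ j<i))
      (trans (cong (_∸ j) (sym (ℕ.m∸[m∸n]≡n i≤n))) (ℕ.∸-+-assoc n (n ∸ i) j)))
    where
    i≤n : i ≤ n
    i≤n = ℕ.<⇒≤ i<n

  -- Rotating the columns by i turns the column j into the offset d = j - i modulo n. Columns before
  -- i wrap round, and there the periodicity of Z enters.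
  row-sum : ∀ Z {i} → Periodic n Z → i < n →
    window (λ j → gate (circAdjℕ n S i j) (Z j)) 0 n ≡ row ((suc a , l) ∷ segs) n Z i
  row-sum Z {i} per i<n = begin
    window F 0 n
      ≡⟨ cong (window F 0) (sym (ℕ.m+[n∸m]≡n i≤n)) ⟩
    window F 0 (i + (n ∸ i))
      ≡⟨ window-++ F 0 i (n ∸ i) ⟩
    window F 0 i +ℤ window F i (n ∸ i)
      ≡⟨ cong₂ _+ℤ_ (window-cong 0 (n ∸ i) i wrapped) (window-cong i 0 (n ∸ i) direct) ⟩
    window G (n ∸ i) i +ℤ window G 0 (n ∸ i)
      ≡⟨ ℤ.+-comm (window G (n ∸ i) i) _ ⟩
    window G 0 (n ∸ i) +ℤ window G (n ∸ i) i
      ≡⟨ window-++ G 0 (n ∸ i) i ⟨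
    window G 0 (n ∸ i + i)
      ≡⟨ cong (window G 0) (ℕ.m∸n+n≡m i≤n) ⟩
    window G 0 n
      ≡⟨ window-+ (λ d → gate (S d) (Z (i + d))) _ 0 n ⟩
    window (λ d → gate (S d) (Z (i + d))) 0 n +ℤ
    window (λ d → gate (S (n ∸ d)) (Z (i + d))) 0 n
      ≡⟨ cong₂ _+ℤ_ (window-tiles _ tiles N≤n)
           (trans (window-mirror n S (λ d → Z (i + d)) S0≡false Sn≡false)
             (window-tiles _ tiles N≤n)) ⟩
    row ((suc a , l) ∷ segs) n Z i ∎
    where
    open ≡-Reasoning
    i≤n : i ≤ n
    i≤n = ℕ.<⇒≤ i<n
    F G : ℕ → ℤ
    F j = gate (circAdjℕ n S i j) (Z j)
    G d = gate (S d) (Z (i + d)) +ℤ gate (S (n ∸ d)) (Z (i + d))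
    direct : ∀ d → d < n ∸ i → F (i + d) ≡ G d
    direct d d<n-i = gate-adj-ahead i d (Z (i + d))
      (ℕ.<-≤-trans (ℕ.+-monoʳ-< i d<n-i) (ℕ.≤-reflexive (ℕ.m+[n∸m]≡n i≤n)))
    wrapped : ∀ j → j < i → F j ≡ G (n ∸ i + j)
    wrapped j j<i = trans (gate-adj-behind j (Z j) j<i i<n)
      (cong (λ x → gate (S (n ∸ i + j)) x +ℤ gate (S (n ∸ (n ∸ i + j))) x)
        (sym (trans (cong Z (trans (sym (ℕ.+-assoc i (n ∸ i) j))
          (cong (_+ j) (ℕ.m+[n∸m]≡n i≤n)))) (per j))))

-- Periodic sequences, reflected offsets and elementary blocks.

periodic-shift : ∀ {p Z} → Periodic p Z → ∀ x k → Z (x + (p + k)) ≡ Z (x + k)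
periodic-shift {p} {Z} per x k = trans (cong Z (swap x p k)) (per (x + k))
  where
  swap : ∀ x p k → x + (p + k) ≡ p + (x + k)
  swap = ℕ-Ring.solve-∀

periodic-* : ∀ {p Z} → Periodic p Z → ∀ j → Periodic (j * p) Z
periodic-* per zero    k = refl
periodic-* {p} {Z} per (suc j) k =
  trans (cong Z (ℕ.+-assoc p (j * p) k)) (trans (per _) (periodic-* per j k))

periodic-% : ∀ {p Z} .{{_ : NonZero p}} → Periodic p Z → ∀ k → Z k ≡ Z (k % p)
periodic-% {p} {Z} per k = begin
  Z k                        ≡⟨ cong Z (m≡m%n+[m/n]*n k p) ⟩
  Z (k % p + k / p * p)      ≡⟨ cong Z (ℕ.+-comm (k % p) _) ⟩
  Z (k / p * p + k % p)      ≡⟨ periodic-* per (k / p) (k % p) ⟩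
  Z (k % p)                  ∎
  where open ≡-Reasoning

periodic-translate : ∀ {p Z} → Periodic p Z → ∀ s → Periodic p (λ k → Z (s + k))
periodic-translate per s k = periodic-shift per s k

window-translate : ∀ Z s a l → window (λ k → Z (s + k)) a l ≡ window Z (s + a) l
window-translate Z s a l =
  window-cong a (s + a) l λ j _ → cong Z (sym (ℕ.+-assoc s a j))

-- Meant for s = N = n/2 and x = N - d: it rewrites the reflected shift T^(n - d) as T^(N - d) T^N.
mirror : ∀ {n} (Z : ℕ → ℤ) k d x s → n ≡ d + (x + s) → Z (k + (n ∸ d)) ≡ Z (x + (s + k))
mirror Z k d x s refl = cong Z
  (trans (cong (λ x → k + x) (ℕ.m+n∸m≡n d (x + s)))
    (trans (ℕ.+-comm k (x + s)) (ℕ.+-assoc x s k)))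

-- The last index a + l - 1 is reflected to the first index b of the image; this accounts for
-- `suc n`.
mirror-window : ∀ {n} (Z : ℕ → ℤ) k a b s l → suc n ≡ a + (l + (b + s)) →
  window (λ d → Z (k + (n ∸ d))) a l ≡ window Z (b + (s + k)) l
mirror-window {n} Z k a b s l eq = window-reverse a (b + (s + k)) l λ i j e →
  trans (mirror Z k (a + i) (b + j) s (ℕ.suc-injective (trans eq
    (trans (cong (λ m → a + (m + (b + s))) (sym e)) (regroup a b s i j)))))
    (cong Z (swap b j (s + k)))
  where
  regroup : ∀ a b s i j → a + (suc (i + j) + (b + s)) ≡ suc (a + i + (b + j + s))
  regroup = ℕ-Ring.solve-∀
  swap : ∀ b j m → b + j + m ≡ b + m + j
  swap = ℕ-Ring.solve-∀

-- The upper bound is inclusive, hence the length `suc l`. The bounds come as equations because `S′`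
-- writes them with division and truncated subtraction.
interval-block : ∀ {a hi} a′ l → a ≡ a′ → hi ≡ a′ + l →
  Block (λ k → (a ≤ᵇ k) ∧ (k ≤ᵇ hi)) a′ (suc l)
interval-block {hi = hi} a l refl refl = record
  { below  = λ {k} k<a → cong (λ b → b ∧ (k ≤ᵇ hi)) (≤ᵇ-false k<a)
  ; inside = λ {k} a≤k k<a+sl → cong₂ _∧_ (≤ᵇ-true a≤k)
      (≤ᵇ-true (ℕ.≤-pred (ℕ.≤-trans k<a+sl (ℕ.≤-reflexive (ℕ.+-suc a l)))))
  ; above  = λ {k} a+sl≤k → cong₂ _∧_
      (≤ᵇ-true (ℕ.≤-trans (ℕ.m≤m+n a (suc l)) a+sl≤k))
      (≤ᵇ-false (ℕ.≤-trans (ℕ.≤-reflexive (sym (ℕ.+-suc a l))) a+sl≤k))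
  }

point-block : ∀ {a} a′ → a ≡ a′ → Block (_≡ᵇ a) a′ 1
point-block a refl = record
  { below  = λ k<a → ≡ᵇ-false (ℕ.<⇒≢ k<a)
  ; inside = λ {k} a≤k k<a+1 → ≡ᵇ-true (ℕ.≤-antisym
      (ℕ.≤-pred (ℕ.≤-trans k<a+1 (ℕ.≤-reflexive (ℕ.+-comm a 1)))) a≤k)
  ; above  = λ {k} a+1≤k → ≡ᵇ-false λ e → ℕ.<-irrefl (sym e)
      (ℕ.≤-trans (ℕ.≤-reflexive (ℕ.+-comm 1 a)) a+1≤k)
  }

near-parts : ∀ {p₁ p₂ p₃ p₄ p₅ p₆ q₁ q₂ q₃ q₄ q₅ q₆ : ℤ} →
  p₁ ≡ q₁ → p₂ ≡ q₂ → p₃ ≡ q₃ → p₄ ≡ q₄ → p₅ ≡ q₅ → p₆ ≡ q₆ →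
  p₁ +ℤ p₂ +ℤ p₃ +ℤ p₄ +ℤ p₅ +ℤ p₆ ≡ q₁ +ℤ q₂ +ℤ q₃ +ℤ q₄ +ℤ q₅ +ℤ q₆
near-parts refl refl refl refl refl refl = refl

-- Descent on bounded integer sequences.

-- Closure under `C` allows `step` to be applied to `C Z` as well, which gives T⁸ = (1 + 2C)² = 1 +
-- 4(C + C²) on Z. The induction on b needs only that D lowers the bound by one; the induction
-- hypothesis then makes D Z 8-periodic, and closure under sums keeps D Z in the class.
descent :
  (L : (ℕ → ℤ) → Set) (C : (ℕ → ℤ) → ℕ → ℤ) (p-1 : ℕ) →
  (∀ {Z} → L Z → Periodic (suc p-1) Z) →
  (∀ {Z} → L Z → L (C Z)) →
  (∀ {Z W} → L Z → L W → L (λ k → Z k +ℤ W k)) →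
  (∀ {Z} → L Z → ∀ k → Z (4 + k) ≡ Z k +ℤ + 2 *ℤ C Z k) →
  ∀ b {Z} → L Z → (∀ k → ∣ Z k ∣ ≤ b) → Periodic 8 Z
descent L C p-1 periodic L-C L-+ step = go
  where
  open ≡-Reasoning
  open import Algebra.Properties.Group (AbelianGroup.group ℤ.+-0-abelianGroup)
    using () renaming (∙-cancelˡ to +-cancelˡ)
  p : ℕ
  p = suc p-1

  D : (ℕ → ℤ) → ℕ → ℤ
  D Z k = C Z k +ℤ C (C Z) k

  step₈ : ∀ {Z} → L Z → ∀ k → Z (8 + k) ≡ Z k +ℤ + 4 *ℤ D Z k
  step₈ {Z} LZ k = begin
    Z (8 + k)
      ≡⟨ step LZ (4 + k) ⟩
    Z (4 + k) +ℤ + 2 *ℤ C Z (4 + k)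
      ≡⟨ cong₂ (λ x y → x +ℤ + 2 *ℤ y) (step LZ k) (step (L-C LZ) k) ⟩
    Z k +ℤ + 2 *ℤ C Z k +ℤ + 2 *ℤ (C Z k +ℤ + 2 *ℤ C (C Z) k)
      ≡⟨ square (Z k) (C Z k) (C (C Z) k) ⟩
    Z k +ℤ + 4 *ℤ D Z k ∎
    where
    square : ∀ x y z →
      x +ℤ + 2 *ℤ y +ℤ + 2 *ℤ (y +ℤ + 2 *ℤ z) ≡ x +ℤ + 4 *ℤ (y +ℤ z)
    square = ℤ-Ring.solve-∀

  bound : ∀ {b Z} → L Z → (∀ k → ∣ Z k ∣ ≤ suc b) → ∀ k → ∣ D Z k ∣ ≤ b
  bound {b} {Z} LZ Z≤b k with ∣ D Z k ∣ ℕ.≤? b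
  ... | yes D≤b = D≤b
  ... | no  D≰b = contradiction 4*suc-b≤2*suc-b
    (ℕ.<⇒≱ (ℕ.*-monoˡ-< (suc b) {2} {4} (s≤s (s≤s (s≤s z≤n)))))
    where
    difference : + 4 *ℤ D Z k ≡ Z (8 + k) -ℤ Z k
    difference = trans (cancel (Z k) (+ 4 *ℤ D Z k)) (cong (_-ℤ Z k) (sym (step₈ LZ k)))
      where
      cancel : ∀ x y → y ≡ x +ℤ y -ℤ x
      cancel = ℤ-Ring.solve-∀
    -- If |D Z k| were at least b + 1, then 4(b + 1) ≤ |Z (8 + k) - Z k| ≤ 2(b + 1).
    4*suc-b≤2*suc-b : 4 * suc b ≤ 2 * suc b
    4*suc-b≤2*suc-b = ℕ.≤-trans (ℕ.*-monoʳ-≤ 4 (ℕ.≰⇒> D≰b))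
      (ℕ.≤-trans (ℕ.≤-reflexive (trans (sym (ℤ.abs-* (+ 4) (D Z k))) (cong ∣_∣ difference)))
      (ℕ.≤-trans (ℤ.∣i-j∣≤∣i∣+∣j∣ (Z (8 + k)) (Z k))
      (ℕ.≤-trans (ℕ.+-mono-≤ (Z≤b (8 + k)) (Z≤b k))
        (ℕ.≤-reflexive (cong (λ x → suc b + x) (sym (ℕ.+-identityʳ (suc b))))))))

  go : ∀ b {Z} → L Z → (∀ k → ∣ Z k ∣ ≤ b) → Periodic 8 Z
  go zero    {Z} LZ Z≤b k = trans (vanish (8 + k)) (sym (vanish k))
    where
    vanish : ∀ k → Z k ≡ 0ℤ
    vanish k = ℤ.∣i∣≡0⇒i≡0 (ℕ.n≤0⇒n≡0 (Z≤b k))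
  go (suc b) {Z} LZ Z≤b k = begin
    Z (8 + k)              ≡⟨ step₈ LZ k ⟩
    Z k +ℤ + 4 *ℤ D Z k    ≡⟨ cong (λ x → Z k +ℤ + 4 *ℤ x) Dk≡0 ⟩
    Z k +ℤ 0ℤ              ≡⟨ ℤ.+-identityʳ (Z k) ⟩
    Z k                    ∎
    where
    D-periodic : Periodic 8 (D Z)
    D-periodic = go b (L-+ (L-C LZ) (L-C (L-C LZ))) (bound LZ Z≤b)
    -- D Z is 8-periodic, so Z grows linearly along 8ℕ; being periodic, it cannot.
    linear : ∀ j → Z (j * 8 + k) ≡ Z k +ℤ + j *ℤ (+ 4 *ℤ D Z k)
    linear zero    = sym (ℤ.+-identityʳ (Z k))
    linear (suc j) = begin
      Z (8 + (j * 8 + k))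
        ≡⟨ step₈ LZ (j * 8 + k) ⟩
      Z (j * 8 + k) +ℤ + 4 *ℤ D Z (j * 8 + k)
        ≡⟨ cong₂ (λ x y → x +ℤ + 4 *ℤ y) (linear j) (periodic-* D-periodic j k) ⟩
      Z k +ℤ + j *ℤ (+ 4 *ℤ D Z k) +ℤ + 4 *ℤ D Z k
        ≡⟨ regroup (Z k) (+ j) (+ 4 *ℤ D Z k) ⟩
      Z k +ℤ (+ 1 +ℤ + j) *ℤ (+ 4 *ℤ D Z k) ∎
      where
      regroup : ∀ x j d → x +ℤ j *ℤ d +ℤ d ≡ x +ℤ (+ 1 +ℤ j) *ℤ d
      regroup = ℤ-Ring.solve-∀
    p*4D≡0 : + p *ℤ (+ 4 *ℤ D Z k) ≡ + p *ℤ 0ℤ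
    p*4D≡0 = trans (+-cancelˡ (Z k) _ _ (begin
      Z k +ℤ + p *ℤ (+ 4 *ℤ D Z k) ≡⟨ linear p ⟨
      Z (p * 8 + k)                ≡⟨ cong (λ x → Z (x + k)) (ℕ.*-comm p 8) ⟩
      Z (8 * p + k)                ≡⟨ periodic-* (periodic LZ) 8 k ⟩
      Z k                          ≡⟨ ℤ.+-identityʳ (Z k) ⟨
      Z k +ℤ 0ℤ                    ∎)) (sym (ℤ.*-zeroʳ (+ p)))
    Dk≡0 : D Z k ≡ 0ℤ
    Dk≡0 = ℤ.*-cancelˡ-≡ (+ 4) _ _ (ℤ.*-cancelˡ-≡ (+ p) _ _ p*4D≡0)

-- Shift polynomials modulo T⁸ - 1.

-- A list of pairs (c , e) encodes the shift polynomial Σ c Tᵉ, where T Z k = Z (1 + k).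
ShiftPoly : Set
ShiftPoly = List (ℤ × ℕ)

eval : ShiftPoly → (ℕ → ℤ) → ℕ → ℤ
eval []            Z k = 0ℤ
eval ((c , e) ∷ P) Z k = c *ℤ Z (e + k) +ℤ eval P Z k

mulMonomial : ℤ → ℕ → ShiftPoly → ShiftPoly
mulMonomial a s []            = []
mulMonomial a s ((c , e) ∷ P) = (a *ℤ c , e + s) ∷ mulMonomial a s P

-- The multiplier is a dense list of coefficients, lowest power first, and s is the exponent that
-- belongs to its head.
mulFrom : ℕ → List ℤ → ShiftPoly → ShiftPoly
mulFrom s []       P = []
mulFrom s (a ∷ as) P = mulMonomial a s P ++ mulFrom (suc s) as P

eval-++ : ∀ P Q Z k → eval (P ++ Q) Z k ≡ eval P Z k +ℤ eval Q Z k
eval-++ []            Q Z k = sym (ℤ.+-identityˡ _)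
eval-++ ((c , e) ∷ P) Q Z k =
  trans (cong (c *ℤ Z (e + k) +ℤ_) (eval-++ P Q Z k)) (sym (ℤ.+-assoc (c *ℤ Z (e + k)) _ _))

eval-mulMonomial : ∀ a s P Z k → eval (mulMonomial a s P) Z k ≡ a *ℤ eval P Z (s + k)
eval-mulMonomial a s []            Z k = sym (ℤ.*-zeroʳ a)
eval-mulMonomial a s ((c , e) ∷ P) Z k = begin
  a *ℤ c *ℤ Z (e + s + k) +ℤ eval (mulMonomial a s P) Z k
    ≡⟨ cong₂ (λ j x → a *ℤ c *ℤ Z j +ℤ x) (ℕ.+-assoc e s k) (eval-mulMonomial a s P Z k) ⟩
  a *ℤ c *ℤ Z (e + (s + k)) +ℤ a *ℤ eval P Z (s + k)
    ≡⟨ factor a c (Z (e + (s + k))) (eval P Z (s + k)) ⟩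
  a *ℤ (c *ℤ Z (e + (s + k)) +ℤ eval P Z (s + k)) ∎
  where
  open ≡-Reasoning
  factor : ∀ a c z y → a *ℤ c *ℤ z +ℤ a *ℤ y ≡ a *ℤ (c *ℤ z +ℤ y)
  factor = ℤ-Ring.solve-∀

eval-mulFrom : ∀ s as {P Z} → (∀ k → eval P Z k ≡ 0ℤ) → ∀ k → eval (mulFrom s as P) Z k ≡ 0ℤ
eval-mulFrom s []       P≡0 k = refl
eval-mulFrom s (a ∷ as) {P} {Z} P≡0 k = begin
  eval (mulMonomial a s P ++ mulFrom (suc s) as P) Z k
    ≡⟨ eval-++ (mulMonomial a s P) _ Z k ⟩
  eval (mulMonomial a s P) Z k +ℤ eval (mulFrom (suc s) as P) Z k
    ≡⟨ cong₂ _+ℤ_ (trans (eval-mulMonomial a s P Z k)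
         (trans (cong (a *ℤ_) (P≡0 (s + k))) (ℤ.*-zeroʳ a))) (eval-mulFrom (suc s) as P≡0 k) ⟩
  0ℤ ∎
  where open ≡-Reasoning

evalDense : List ℤ → (ℕ → ℤ) → ℕ → ℤ
evalDense []       Z k = 0ℤ
evalDense (a ∷ as) Z k = a *ℤ Z k +ℤ evalDense as Z (suc k)

addAt : ℕ → ℤ → List ℤ → List ℤ
addAt zero    c []       = c ∷ []
addAt zero    c (a ∷ as) = c +ℤ a ∷ as
addAt (suc e) c []       = 0ℤ ∷ addAt e c []
addAt (suc e) c (a ∷ as) = a ∷ addAt e c as

eval-addAt : ∀ e c as Z k → evalDense (addAt e c as) Z k ≡ c *ℤ Z (e + k) +ℤ evalDense as Z k
eval-addAt zero    c []       Z k = refl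
eval-addAt zero    c (a ∷ as) Z k = distrib c a (Z k) _
  where
  distrib : ∀ c a z y → (c +ℤ a) *ℤ z +ℤ y ≡ c *ℤ z +ℤ (a *ℤ z +ℤ y)
  distrib = ℤ-Ring.solve-∀
eval-addAt (suc e) c []       Z k = trans (ℤ.+-identityˡ _)
  (trans (eval-addAt e c [] Z (suc k)) (cong (λ j → c *ℤ Z j +ℤ 0ℤ) (ℕ.+-suc e k)))
eval-addAt (suc e) c (a ∷ as) Z k = begin
  a *ℤ Z k +ℤ evalDense (addAt e c as) Z (suc k)
    ≡⟨ cong (a *ℤ Z k +ℤ_) (trans (eval-addAt e c as Z (suc k))
         (cong (λ j → c *ℤ Z j +ℤ evalDense as Z (suc k)) (ℕ.+-suc e k))) ⟩
  a *ℤ Z k +ℤ (c *ℤ Z (suc e + k) +ℤ evalDense as Z (suc k))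
    ≡⟨ swap (a *ℤ Z k) (c *ℤ Z (suc e + k)) _ ⟩
  c *ℤ Z (suc e + k) +ℤ (a *ℤ Z k +ℤ evalDense as Z (suc k)) ∎
  where
  open ≡-Reasoning
  swap : ∀ x y z → x +ℤ (y +ℤ z) ≡ y +ℤ (x +ℤ z)
  swap = ℤ-Ring.solve-∀

-- Padded to length 8 so that equal residues modulo T⁸ - 1 are equal lists.
residue : ShiftPoly → List ℤ
residue []            = replicate 8 0ℤ
residue ((c , e) ∷ P) = addAt (e % 8) c (residue P)

eval-residue : ∀ {Z} → Periodic 8 Z → ∀ P k → eval P Z k ≡ evalDense (residue P) Z k
eval-residue         per []            k = refl
eval-residue {Z} per ((c , e) ∷ P) k = begin
  c *ℤ Z (e + k) +ℤ eval P Z k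
    ≡⟨ cong₂ (λ z y → c *ℤ z +ℤ y)
         (periodic-% {Z = λ x → Z (x + k)} (λ x → per (x + k)) e) (eval-residue per P k) ⟩
  c *ℤ Z (e % 8 + k) +ℤ evalDense (residue P) Z k
    ≡⟨ eval-addAt (e % 8) c (residue P) Z k ⟨
  evalDense (addAt (e % 8) c (residue P)) Z k ∎
  where
  open ≡-Reasoning

-- Both sides of the identity act equally on the 8-periodic Z; the left one kills it because P does,
-- and the factor 1 + d cancels. The identity compares closed lists, so for concrete P it can be
-- checked by evaluation.
bézout⇒2-periodic : ∀ {Z} P d as → Periodic 8 Z → (∀ k → eval P Z k ≡ 0ℤ) →
  residue (mulFrom 0 as P) ≡ residue ((+ suc d , 2) ∷ (-[1+ d ] , 0) ∷ []) → Periodic 2 Z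
bézout⇒2-periodic {Z} P d as per P≡0 identity k =
  ℤ.i-j≡0⇒i≡j _ _ (ℤ.*-cancelˡ-≡ (+ suc d) _ 0ℤ (begin
    + suc d *ℤ (Z (2 + k) -ℤ Z k)
      ≡⟨ expand (+ suc d) (Z (2 + k)) (Z k) ⟩
    eval T²-1 Z k
      ≡⟨ eval-residue per T²-1 k ⟩
    evalDense (residue T²-1) Z k
      ≡⟨ cong (λ R → evalDense R Z k) identity ⟨
    evalDense (residue (mulFrom 0 as P)) Z k
      ≡⟨ eval-residue per (mulFrom 0 as P) k ⟨
    eval (mulFrom 0 as P) Z k
      ≡⟨ eval-mulFrom 0 as P≡0 k ⟩
    0ℤ
      ≡⟨ ℤ.*-zeroʳ (+ suc d) ⟨
    + suc d *ℤ 0ℤ ∎))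
  where
  open ≡-Reasoning
  T²-1 : ShiftPoly
  T²-1 = (+ suc d , 2) ∷ (-[1+ d ] , 0) ∷ []
  expand : ∀ c x y → c *ℤ (x -ℤ y) ≡ c *ℤ x +ℤ (-ℤ c *ℤ y +ℤ 0ℤ)
  expand = ℤ-Ring.solve-∀

-- T - 1 times the row equation, where Tᵘ, T^(N - t) and Tʰ act as Tʳ, Tʳ′ and Tˢ.
differencedRow : (r r′ s : ℕ) → ShiftPoly
differencedRow r r′ s =
  (+ 1 , 5) ∷ (-[1+ 0 ] , 4) ∷ (+ 2 , 3) ∷ (-[1+ 1 ] , 2) ∷ (+ 1 , 1) ∷ (-[1+ 0 ] , 0) ∷
  (+ 2 , 4 + r + s) ∷ (-[1+ 1 ] , 3 + s) ∷ (+ 2 , 7 + r + s) ∷ (-[1+ 1 ] , 5 + r + s) ∷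
  (+ 2 , 4 + r′ + s) ∷ (-[1+ 1 ] , 2 + r′ + s) ∷ (+ 2 , 2 + s) ∷ (-[1+ 1 ] , 5 + r′ + s) ∷ []

-- Here u = t - 4 acts as r = 2w and h as 2x. As T^N = 1, T^(N - t) is T^(-4 - r) = T^(12 - r); 16
-- rather than 8 is added to the exponent since r can be 6 and 4 - r would be truncated.
differencedRow₈ : (w x : Fin 4) → ShiftPoly
differencedRow₈ w x = differencedRow (toℕ w * 2) (12 ∸ toℕ w * 2) (toℕ x * 2)

-- (d , A) stands for the Bézout identity A · differencedRow₈ w x ≡ (1 + d) (T² - 1) modulo T⁸ - 1.
bézout : (w x : Fin 4) → ℕ × List ℤ
bézout 0F 0F = 7 , + 1 ∷ + 1 ∷ + 4 ∷ + 4 ∷ + 1 ∷ + 1 ∷ []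
bézout 0F 1F = 39 , + 7 ∷ + 7 ∷ -[1+ 3 ] ∷ -[1+ 3 ] ∷ -[1+ 0 ] ∷ -[1+ 0 ] ∷ []
bézout 0F 2F = 23 , -[1+ 4 ] ∷ -[1+ 4 ] ∷ -[1+ 3 ] ∷ -[1+ 3 ] ∷ -[1+ 4 ] ∷ -[1+ 4 ] ∷ []
bézout 0F 3F = 39 , -[1+ 0 ] ∷ -[1+ 0 ] ∷ -[1+ 3 ] ∷ -[1+ 3 ] ∷ + 7 ∷ + 7 ∷ []
bézout 1F 0F = 15 , + 5 ∷ + 13 ∷ + 16 ∷ + 16 ∷ + 13 ∷ + 5 ∷ []
bézout 1F 1F = 47 , + 1 ∷ -[1+ 6 ] ∷ + 0 ∷ -[1+ 15 ] ∷ -[1+ 6 ] ∷ -[1+ 14 ] ∷ []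
bézout 1F 2F = 15 , + 5 ∷ -[1+ 2 ] ∷ + 0 ∷ + 0 ∷ -[1+ 2 ] ∷ + 5 ∷ []
bézout 1F 3F = 47 , -[1+ 14 ] ∷ -[1+ 6 ] ∷ -[1+ 15 ] ∷ + 0 ∷ -[1+ 6 ] ∷ + 1 ∷ []
bézout 2F 0F = 7 , -[1+ 2 ] ∷ -[1+ 2 ] ∷ -[1+ 3 ] ∷ -[1+ 3 ] ∷ -[1+ 2 ] ∷ -[1+ 2 ] ∷ []
bézout 2F 1F = 7 , -[1+ 0 ] ∷ -[1+ 0 ] ∷ -[1+ 3 ] ∷ -[1+ 3 ] ∷ -[1+ 0 ] ∷ -[1+ 0 ] ∷ []
bézout 2F 2F = 7 , -[1+ 2 ] ∷ -[1+ 2 ] ∷ -[1+ 3 ] ∷ -[1+ 3 ] ∷ -[1+ 2 ] ∷ -[1+ 2 ] ∷ []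
bézout 2F 3F = 7 , -[1+ 0 ] ∷ -[1+ 0 ] ∷ -[1+ 3 ] ∷ -[1+ 3 ] ∷ -[1+ 0 ] ∷ -[1+ 0 ] ∷ []
bézout 3F 0F = 15 , -[1+ 2 ] ∷ -[1+ 10 ] ∷ -[1+ 15 ] ∷ -[1+ 15 ] ∷ -[1+ 10 ] ∷ -[1+ 2 ] ∷ []
bézout 3F 1F = 271 , -[1+ 12 ] ∷ -[1+ 52 ] ∷ -[1+ 79 ] ∷ -[1+ 95 ] ∷ -[1+ 100 ] ∷ -[1+ 76 ] ∷ []
bézout 3F 2F = 111 , -[1+ 4 ] ∷ -[1+ 12 ] ∷ -[1+ 31 ] ∷ -[1+ 31 ] ∷ -[1+ 12 ] ∷ -[1+ 4 ] ∷ []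
bézout 3F 3F = 271 , -[1+ 76 ] ∷ -[1+ 100 ] ∷ -[1+ 95 ] ∷ -[1+ 79 ] ∷ -[1+ 52 ] ∷ -[1+ 12 ] ∷ []

-- Six coefficients suffice: the multiplier inverts the row divided by T² - 1, up to the factor 1 +
-- d, modulo (T⁸ - 1)/(T² - 1), which has degree 6.
bézout-correct : ∀ w x → let d , as = bézout w x in
  residue (mulFrom 0 as (differencedRow₈ w x)) ≡
  residue ((+ suc d , 2) ∷ (-[1+ d ] , 0) ∷ [])
bézout-correct 0F 0F = refl
bézout-correct 0F 1F = refl
bézout-correct 0F 2F = refl
bézout-correct 0F 3F = refl
bézout-correct 1F 0F = refl
bézout-correct 1F 1F = refl
bézout-correct 1F 2F = refl
bézout-correct 1F 3F = refl
bézout-correct 2F 0F = refl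
bézout-correct 2F 1F = refl
bézout-correct 2F 2F = refl
bézout-correct 2F 3F = refl
bézout-correct 3F 0F = refl
bézout-correct 3F 1F = refl
bézout-correct 3F 2F = refl
bézout-correct 3F 3F = refl

differencedRow⇒2-periodic : ∀ {Z} (w x : Fin 4) → Periodic 8 Z →
  (∀ k → eval (differencedRow₈ w x) Z k ≡ 0ℤ) → Periodic 2 Z
differencedRow⇒2-periodic {Z} w x per row≡0 =
  bézout⇒2-periodic (differencedRow₈ w x) _ (proj₂ (bézout w x)) per row≡0 (bézout-correct w x)

-- Reduced shifts, bounds and the alternating sequence.

Shift : ℕ → ℕ → (ℕ → ℤ) → Set
Shift a b Z = ∀ k → Z (a + k) ≡ Z (b + k)

shift-under : ∀ a b Z → Shift a b Z → ∀ x k → Z (x + (a + k)) ≡ Z (x + (b + k))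
shift-under a b Z sh x k =
  trans (cong Z (swap x a k)) (trans (sh (x + k)) (cong Z (swap b x k)))
  where
  swap : ∀ x a k → x + (a + k) ≡ a + (x + k)
  swap = ℕ-Ring.solve-∀

even-residue : ∀ {Z} → Periodic 8 Z → ∀ v →
  ∃ λ (w : Fin 4) → Shift (v * 2) (toℕ w * 2) Z
even-residue {Z} per v with v divMod 4
... | result j w refl = w , λ k →
  trans (cong Z (regroup (toℕ w) j k)) (periodic-* per j (toℕ w * 2 + k))
  where
  regroup : ∀ w j k → (w + j * 4) * 2 + k ≡ j * 8 + (w * 2 + k)
  regroup = ℕ-Ring.solve-∀

window-2-periodic : ∀ {Z} → Periodic 2 Z → ∀ a v →
  window Z a (v * 2) ≡ + v *ℤ (Z a +ℤ Z (1 + a))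
window-2-periodic per a zero    = refl
window-2-periodic {Z} per a (suc v) = begin
  Z a +ℤ (Z (1 + a) +ℤ window Z (2 + a) (v * 2))
    ≡⟨ cong (λ w → Z a +ℤ (Z (1 + a) +ℤ w)) (trans (window-2-periodic per (2 + a) v)
         (cong₂ (λ x y → + v *ℤ (x +ℤ y)) (per a) (per (1 + a)))) ⟩
  Z a +ℤ (Z (1 + a) +ℤ + v *ℤ (Z a +ℤ Z (1 + a)))
    ≡⟨ collect (Z a) (Z (1 + a)) (+ v) ⟩
  (+ 1 +ℤ + v) *ℤ (Z a +ℤ Z (1 + a)) ∎
  where
  open ≡-Reasoning
  collect : ∀ x y v → x +ℤ (y +ℤ v *ℤ (x +ℤ y)) ≡ (+ 1 +ℤ v) *ℤ (x +ℤ y)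
  collect = ℤ-Ring.solve-∀

bounded-initially : ∀ (Z : ℕ → ℤ) m → ∃ λ b → ∀ k → k < m → ∣ Z k ∣ ≤ b
bounded-initially Z zero    = 0 , λ _ ()
bounded-initially Z (suc m) with bounded-initially Z m
... | b , Z≤b = b + ∣ Z m ∣ , λ k k<1+m → bound k (ℕ.m<1+n⇒m<n∨m≡n k<1+m)
  where
  bound : ∀ k → k < m ⊎ k ≡ m → ∣ Z k ∣ ≤ b + ∣ Z m ∣
  bound k (inj₁ k<m)  = ℕ.≤-trans (Z≤b k k<m) (ℕ.m≤m+n b _)
  bound k (inj₂ refl) = ℕ.m≤n+m ∣ Z m ∣ b

periodic⇒bounded : ∀ {p Z} .{{_ : NonZero p}} → Periodic p Z → ∃ λ b → ∀ k → ∣ Z k ∣ ≤ b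
periodic⇒bounded {p} {Z} per with bounded-initially Z p
... | b , Z≤b = b , λ k →
  ℕ.≤-trans (ℕ.≤-reflexive (cong ∣_∣ (periodic-% per k))) (Z≤b (k % p) (m%n<n k p))

alternating : ℕ → ℤ
alternating zero    = + 1
alternating (suc k) = -ℤ alternating k

alternating-2-periodic : Periodic 2 alternating
alternating-2-periodic k = ℤ.neg-involutive (alternating k)

alternating≢0 : ∀ k → alternating k ≢ 0ℤ
alternating≢0 (suc k) eq = alternating≢0 k
  (trans (sym (ℤ.neg-involutive (alternating k))) (cong -ℤ_ eq))

alternating-multiple : ∀ (Z : ℕ → ℤ) → (∀ k → Z (1 + k) ≡ -ℤ Z k) → ∀ k → Z k ≡ alternating k *ℤ Z 0
alternating-multiple Z alt zero    = sym (ℤ.*-identityˡ (Z 0))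
alternating-multiple Z alt (suc k) = trans (alt k)
  (trans (cong -ℤ_ (alternating-multiple Z alt k)) (ℤ.neg-distribˡ-* (alternating k) (Z 0)))

-- From rational vectors to periodic integer sequences.

fromℤ-injective : ∀ {x y} → fromℤ x ≡ fromℤ y → x ≡ y
fromℤ-injective = cong ↥_

fromℤ-+ : ∀ x y → fromℤ (x +ℤ y) ≡ fromℤ x +ℚ fromℤ y
fromℤ-+ x y = ℚ.toℚᵘ-injective (ℚᵘ.≃-trans (ℚᵘ.*≡* (unit x y))
  (ℚᵘ.≃-sym (ℚ.toℚᵘ-homo-+ (fromℤ x) (fromℤ y))))
  where
  unit : ∀ x y → (x +ℤ y) *ℤ + 1 ≡ (x *ℤ + 1 +ℤ y *ℤ + 1) *ℤ + 1
  unit = ℤ-Ring.solve-∀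

fromℤ-* : ∀ x y → fromℤ (x *ℤ y) ≡ fromℤ x *ℚ fromℤ y
fromℤ-* x y = ℚ.toℚᵘ-injective (ℚᵘ.≃-trans (ℚᵘ.*≡* refl)
  (ℚᵘ.≃-sym (ℚ.toℚᵘ-homo-* (fromℤ x) (fromℤ y))))

fromℤ-denominator : ∀ p → ∃ λ d → ∃ λ x → fromℤ (+ suc d) *ℚ p ≡ fromℤ x
fromℤ-denominator p@(mkℚ x d _) = d , x , ℚ.toℚᵘ-injective
  (ℚᵘ.≃-trans (ℚ.toℚᵘ-homo-* (fromℤ (+ suc d)) p) (ℚᵘ.*≡* (trans (comm x (+ suc d))
    (cong (λ y → x *ℤ + suc y) (sym (ℕ.+-identityʳ d))))))
  where
  comm : ∀ x d → d *ℤ x *ℤ + 1 ≡ x *ℤ d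
  comm = ℤ-Ring.solve-∀

*-cancelˡ : ∀ p {q r} .{{_ : Rational.NonZero p}} → p *ℚ q ≡ p *ℚ r → q ≡ r
*-cancelˡ p {q} {r} eq = begin
  q                  ≡⟨ unit q ⟨
  1/ p *ℚ (p *ℚ q)   ≡⟨ cong (1/ p *ℚ_) eq ⟩
  1/ p *ℚ (p *ℚ r)   ≡⟨ unit r ⟩
  r                  ∎
  where
  open ≡-Reasoning
  unit : ∀ q → 1/ p *ℚ (p *ℚ q) ≡ q
  unit q = trans (sym (ℚ.*-assoc (1/ p) p q))
    (trans (cong (_*ℚ q) (ℚ.*-inverseˡ p)) (ℚ.*-identityˡ q))

swapℚ : ∀ a b c → a *ℚ (b *ℚ c) ≡ b *ℚ (a *ℚ c)
swapℚ a b c = trans (sym (ℚ.*-assoc a b c))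
  (trans (cong (_*ℚ c) (ℚ.*-comm a b)) (ℚ.*-assoc b a c))

clear-denominators : ∀ {m} (y : Fin m → ℚ) →
  ∃ λ d → ∃ λ (z : Fin m → ℤ) → ∀ i → fromℤ (+ suc d) *ℚ y i ≡ fromℤ (z i)
clear-denominators {zero}  y = 0 , (λ ()) , λ ()
clear-denominators {suc m} y
  with fromℤ-denominator (y Fin.zero) | clear-denominators (λ i → y (Fin.suc i))
-- The new denominator is (1 + a)(1 + b), whose predecessor is b + a(1 + b).
... | a , x , eq | b , z , eqs = b + a * suc b , z′ , eqs′
  where
  open ≡-Reasoning
  A B : ℚ
  A = fromℤ (+ suc a)
  B = fromℤ (+ suc b)
  z′ : Fin (suc m) → ℤ
  z′ Fin.zero    = + suc b *ℤ x
  z′ (Fin.suc i) = + suc a *ℤ z i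
  split : ∀ q → fromℤ (+ suc (b + a * suc b)) *ℚ q ≡ A *ℚ (B *ℚ q)
  split q = trans
    (cong (_*ℚ q) (trans (cong fromℤ (ℤ.pos-* (suc a) (suc b))) (fromℤ-* (+ suc a) (+ suc b))))
    (ℚ.*-assoc A B q)
  eqs′ : ∀ i → fromℤ (+ suc (b + a * suc b)) *ℚ y i ≡ fromℤ (z′ i)
  eqs′ Fin.zero = begin
    fromℤ (+ suc (b + a * suc b)) *ℚ y Fin.zero  ≡⟨ split (y Fin.zero) ⟩
    A *ℚ (B *ℚ y Fin.zero)                       ≡⟨ swapℚ A B (y Fin.zero) ⟩
    B *ℚ (A *ℚ y Fin.zero)                       ≡⟨ cong (B *ℚ_) eq ⟩
    B *ℚ fromℤ x                                 ≡⟨ fromℤ-* (+ suc b) x ⟨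
    fromℤ (+ suc b *ℤ x)                         ∎
  eqs′ (Fin.suc i) = begin
    fromℤ (+ suc (b + a * suc b)) *ℚ y (Fin.suc i)  ≡⟨ split (y (Fin.suc i)) ⟩
    A *ℚ (B *ℚ y (Fin.suc i))                       ≡⟨ cong (A *ℚ_) (eqs i) ⟩
    A *ℚ fromℤ (z i)                                ≡⟨ fromℤ-* (+ suc a) (z i) ⟨
    fromℤ (+ suc a *ℤ z i)                          ∎

sumFin-cong : ∀ m {f g} → (∀ j → f j ≡ g j) → sumFin m f ≡ sumFin m g
sumFin-cong zero    eq = refl
sumFin-cong (suc m) eq = cong₂ _+ℚ_ (eq Fin.zero) (sumFin-cong m λ j → eq (Fin.suc j))

sumFin-*ˡ : ∀ m q f → sumFin m (λ j → q *ℚ f j) ≡ q *ℚ sumFin m f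
sumFin-*ˡ zero    q f = sym (ℚ.*-zeroʳ q)
sumFin-*ˡ (suc m) q f = trans (cong (q *ℚ f Fin.zero +ℚ_) (sumFin-*ˡ m q λ j → f (Fin.suc j)))
  (sym (ℚ.*-distribˡ-+ q (f Fin.zero) _))

sumFin-window : ∀ m (g : ℕ → ℤ) a {f} → (∀ j → f j ≡ fromℤ (g (a + toℕ j))) →
  sumFin m f ≡ fromℤ (window g a m)
sumFin-window zero    g a eq = refl
sumFin-window (suc m) g a eq = trans
  (cong₂ _+ℚ_ (trans (eq Fin.zero) (cong (λ x → fromℤ (g x)) (ℕ.+-identityʳ a)))
    (sumFin-window m g (suc a) λ j →
      trans (eq (Fin.suc j)) (cong (λ x → fromℤ (g x)) (ℕ.+-suc a (toℕ j)))))
  (sym (fromℤ-+ (g a) (window g (suc a) m)))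

-- Turns a degree into the row sum of the constant sequence 1, so that regularity follows from the
-- row formula used for null vectors.
count-window : ∀ {A : Set} (p : A → Bool) (g : ℕ → Bool) {m} (f : Fin m → A) a →
  (∀ j → p (f j) ≡ g (a + toℕ j)) →
  + length (filter (λ x → T? (p x)) (tabulate f)) ≡ window (λ k → gate (g k) (+ 1)) a m
count-window p g {zero}  f a eq = refl
count-window p g {suc m} f a eq
  with p (f Fin.zero) | trans (eq Fin.zero) (cong g (ℕ.+-identityʳ a))
     | count-window p g (λ j → f (Fin.suc j)) (suc a)
         (λ j → trans (eq (Fin.suc j)) (cong g (ℕ.+-suc a (toℕ j))))
... | true  | ga | ih rewrite sym ga = cong (+ 1 +ℤ_) ih
... | false | ga | ih rewrite sym ga = trans ih (sym (ℤ.+-identityˡ _))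

extend : ∀ {m} .{{_ : NonZero m}} → (Fin m → ℤ) → ℕ → ℤ
extend {m} z k = z (k mod m)

extend-toℕ : ∀ {m} .{{_ : NonZero m}} (z : Fin m → ℤ) i → extend z (toℕ i) ≡ z i
extend-toℕ {m} z i = cong z (Fin.toℕ-injective
  (trans (Fin.toℕ-fromℕ< (m%n<n (toℕ i) m)) (m<n⇒m%n≡m (Fin.toℕ<n i))))

extend-periodic : ∀ {m} .{{_ : NonZero m}} (z : Fin m → ℤ) → Periodic m (extend z)
extend-periodic {m} z k = cong z (Fin.fromℕ<-cong _ _
  (trans (cong (_% m) (ℕ.+-comm m k)) ([m+n]%n≡m%n k m)) (m%n<n (m + k) m) (m%n<n k m))

adjMatrix-fromℤ : ∀ n S i j x → adjMatrix n S i j *ℚ fromℤ x ≡ fromℤ (gate (circAdj n S i j) x)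
adjMatrix-fromℤ n S i j x with circAdj n S i j
... | true  = ℚ.*-identityˡ (fromℤ x)
... | false = ℚ.*-zeroˡ (fromℤ x)

-- The generator set and its row equation.

-- t = 4 + u and c is the slack in 4t + 16 ≤ n, so that n/4 = h and n/2 = N.
module Graph (u c : ℕ) where
  open ≡-Reasoning

  t h N n : ℕ
  t = 4 + u
  h = 8 + (u + c)
  N = h + h
  n = N + N

  -- Since N = t + 4 + c + h, the last three segments are N - t, N - (t - 1) and the run from N - (t
  -- - 3) to N - 1.
  segs : Segments
  segs = (1 , 1 + u) ∷ (3 + u , 1) ∷ (4 + u , 1) ∷ (h , 1) ∷ (2 + h , 1) ∷
         (4 + c + h , 1) ∷ (5 + c + h , 1) ∷ (7 + c + h , 1 + u) ∷ []

  n/4≡h : n / 4 ≡ h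
  n/4≡h = trans (cong (_/ 4) (quadruple h)) (m*n/n≡m h 4)
    where
    quadruple : ∀ x → x + x + (x + x) ≡ x * 4
    quadruple = ℕ-Ring.solve-∀

  n/2≡N : n / 2 ≡ N
  n/2≡N = trans (cong (_/ 2) (double N)) (m*n/n≡m N 2)
    where
    double : ∀ x → x + x ≡ x * 2
    double = ℕ-Ring.solve-∀

  n/2∸ : ∀ {x} y → N ≡ y + x → n / 2 ∸ x ≡ y
  n/2∸ {x} y eq = trans (cong (_∸ x) (trans n/2≡N eq)) (ℕ.m+n∸n≡m y x)

  S′-tiles : Tiles N (S′ t n) segs
  S′-tiles =
    cons (interval-block 1 u refl refl) (ℕ.n≤1+n (2 + u)) (
    cons (point-block (3 + u) refl) (ℕ.≤-reflexive (ℕ.+-comm (3 + u) 1)) (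
    cons (point-block (4 + u) refl)
      (ℕ.≤-trans (ℕ.≤-reflexive (ℕ.+-comm (4 + u) 1))
        (ℕ.+-mono-≤ {5} {8} (ℕ.m≤m+n 5 3) (ℕ.m≤m+n u c))) (
    cons (point-block h n/4≡h) (ℕ.≤-trans (ℕ.≤-reflexive (ℕ.+-comm h 1)) (ℕ.n≤1+n (1 + h))) (
    cons (point-block (2 + h) (trans (cong (_+ 2) n/4≡h) (ℕ.+-comm h 2)))
      (ℕ.≤-trans (ℕ.≤-reflexive (ℕ.+-comm (2 + h) 1))
        (s≤s (s≤s (s≤s (ℕ.m≤n⇒m≤1+n (ℕ.m≤n+m h c)))))) (
    cons (point-block (4 + c + h) (n/2∸ (4 + c + h) (gap₄ u c)))
      (ℕ.≤-reflexive (ℕ.+-comm (4 + c + h) 1)) (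
    cons (point-block (5 + c + h) (n/2∸ (5 + c + h) (gap₃ u c)))
      (ℕ.≤-trans (ℕ.≤-reflexive (ℕ.+-comm (5 + c + h) 1)) (ℕ.n≤1+n (6 + c + h))) (
    last (interval-block (7 + c + h) u (n/2∸ (7 + c + h) (gap₁ u c))
        (n/2∸ (7 + c + h + u) (gap₀ u c)))
      (ℕ.≤-reflexive (end u c)))))))))
    where
    gap₄ : ∀ u c → 8 + (u + c) + (8 + (u + c)) ≡ 4 + c + (8 + (u + c)) + (4 + u)
    gap₄ = ℕ-Ring.solve-∀
    gap₃ : ∀ u c → 8 + (u + c) + (8 + (u + c)) ≡ 5 + c + (8 + (u + c)) + (3 + u)
    gap₃ = ℕ-Ring.solve-∀
    gap₁ : ∀ u c → 8 + (u + c) + (8 + (u + c)) ≡ 7 + c + (8 + (u + c)) + (1 + u)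
    gap₁ = ℕ-Ring.solve-∀
    gap₀ : ∀ u c → 8 + (u + c) + (8 + (u + c)) ≡ 7 + c + (8 + (u + c)) + u + 1
    gap₀ = ℕ-Ring.solve-∀
    end : ∀ u c → 7 + c + (8 + (u + c)) + (1 + u) ≡ 8 + (u + c) + (8 + (u + c))
    end = ℕ-Ring.solve-∀

  -- Sums over S′ without h and 2 + h; this part of S′ is invariant under s ↦ N - s.
  near : (ℕ → ℤ) → ℕ → ℤ
  near Z k = window Z (1 + k) (1 + u) +ℤ Z (3 + u + k) +ℤ Z (4 + u + k) +ℤ
    Z (4 + c + h + k) +ℤ Z (5 + c + h + k) +ℤ window Z (7 + c + h + k) (1 + u)

  rowS : (ℕ → ℤ) → ℕ → ℤ
  rowS = row segs n

  segSum-segs : ∀ f → segSum segs f ≡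
    window f 1 (1 + u) +ℤ f (3 + u) +ℤ f (4 + u) +ℤ f (4 + c + h) +ℤ f (5 + c + h) +ℤ
    window f (7 + c + h) (1 + u) +ℤ f h +ℤ f (2 + h)
  segSum-segs f = collect (window f 1 (1 + u)) (f (3 + u)) (f (4 + u)) (f h) (f (2 + h))
    (f (4 + c + h)) (f (5 + c + h)) (window f (7 + c + h) (1 + u))
    where
    collect : ∀ a b d e f g i j →
      a +ℤ (b +ℤ 0ℤ +ℤ (d +ℤ 0ℤ +ℤ (e +ℤ 0ℤ +ℤ (f +ℤ 0ℤ +ℤ (g +ℤ 0ℤ +ℤ (i +ℤ 0ℤ +ℤ (j +ℤ 0ℤ)))))))
      ≡ a +ℤ b +ℤ d +ℤ g +ℤ i +ℤ j +ℤ e +ℤ f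
    collect = ℤ-Ring.solve-∀

  -- Write T^(n - d) as T^N T^(N - d). The reflection d ↦ N - d permutes the generators in `near`
  -- and fixes h, but moves 2 + h to h - 2 = 6 + u + c, the only asymmetric term.
  row-near : ∀ Z k → rowS Z k ≡
    (near Z k +ℤ Z (h + k) +ℤ Z (2 + h + k)) +ℤ
    (near Z (N + k) +ℤ Z (h + (N + k)) +ℤ Z (6 + u + c + (N + k)))
  row-near Z k = cong₂ _+ℤ_
    (trans (segSum-segs (λ d → Z (k + d)))
      (cong₂ _+ℤ_ (cong₂ _+ℤ_
        (near-parts (direct-window 1 (1 + u)) (direct (3 + u)) (direct (4 + u))
          (direct (4 + c + h)) (direct (5 + c + h)) (direct-window (7 + c + h) (1 + u)))
        (direct h)) (direct (2 + h))))
    (trans (trans (segSum-segs f)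
        (flip (window f 1 (1 + u)) (f (3 + u)) (f (4 + u))
          (f (4 + c + h)) (f (5 + c + h)) (window f (7 + c + h) (1 + u)) (f h) (f (2 + h))))
      (cong₂ _+ℤ_ (cong₂ _+ℤ_
        (near-parts (mirror-window Z k (7 + c + h) 1 N (1 + u) (m₇ u c))
          (mirror Z k (5 + c + h) (3 + u) N (m₆ u c))
          (mirror Z k (4 + c + h) (4 + u) N (m₅ u c))
          (mirror Z k (4 + u) (4 + c + h) N (m₃ u c))
          (mirror Z k (3 + u) (5 + c + h) N (m₂ u c))
          (mirror-window Z k 1 (7 + c + h) N (1 + u) (m₁ u c)))
        (mirror Z k h h N (m₄ u c))) (mirror Z k (2 + h) (6 + u + c) N (m₈ u c))))
    where
    f : ℕ → ℤ
    f d = Z (k + (n ∸ d))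
    direct : ∀ x → Z (k + x) ≡ Z (x + k)
    direct x = cong Z (ℕ.+-comm k x)
    direct-window : ∀ a l → window (λ d → Z (k + d)) a l ≡ window Z (a + k) l
    direct-window a l = trans (window-translate Z k a l) (cong (λ b → window Z b l) (ℕ.+-comm k a))
    flip : ∀ a b d g i j e f →
      a +ℤ b +ℤ d +ℤ g +ℤ i +ℤ j +ℤ e +ℤ f ≡ j +ℤ i +ℤ g +ℤ d +ℤ b +ℤ a +ℤ e +ℤ f
    flip = ℤ-Ring.solve-∀
    m₁ : ∀ u c → let h = 8 + (u + c); N = h + h in
      suc (N + N) ≡ 1 + (1 + u + (7 + c + h + N))
    m₁ = ℕ-Ring.solve-∀
    m₂ : ∀ u c → let h = 8 + (u + c); N = h + h in N + N ≡ 3 + u + (5 + c + h + N)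
    m₂ = ℕ-Ring.solve-∀
    m₃ : ∀ u c → let h = 8 + (u + c); N = h + h in N + N ≡ 4 + u + (4 + c + h + N)
    m₃ = ℕ-Ring.solve-∀
    m₄ : ∀ u c → let h = 8 + (u + c); N = h + h in N + N ≡ h + (h + N)
    m₄ = ℕ-Ring.solve-∀
    m₅ : ∀ u c → let h = 8 + (u + c); N = h + h in N + N ≡ 4 + c + h + (4 + u + N)
    m₅ = ℕ-Ring.solve-∀
    m₆ : ∀ u c → let h = 8 + (u + c); N = h + h in N + N ≡ 5 + c + h + (3 + u + N)
    m₆ = ℕ-Ring.solve-∀
    m₇ : ∀ u c → let h = 8 + (u + c); N = h + h in
      suc (N + N) ≡ 7 + c + h + (1 + u + (1 + N))
    m₇ = ℕ-Ring.solve-∀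
    m₈ : ∀ u c → let h = 8 + (u + c); N = h + h in N + N ≡ 2 + h + (6 + u + c + N)
    m₈ = ℕ-Ring.solve-∀

  near-cong : ∀ Z W k l → (∀ x → Z (x + k) ≡ W (x + l)) → near Z k ≡ near W l
  near-cong Z W k l eq = near-parts (windows 1 (1 + u)) (eq (3 + u)) (eq (4 + u))
    (eq (4 + c + h)) (eq (5 + c + h)) (windows (7 + c + h) (1 + u))
    where
    swap : ∀ a k j → a + k + j ≡ a + j + k
    swap = ℕ-Ring.solve-∀
    windows : ∀ a m → window Z (a + k) m ≡ window W (a + l) m
    windows a m = window-cong (a + k) (a + l) m λ j _ →
      trans (cong Z (swap a k j)) (trans (eq (a + j)) (cong W (swap a j l)))

  near-periodic : ∀ {p Z} → Periodic p Z → ∀ k → near Z (p + k) ≡ near Z k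
  near-periodic {p} {Z} per k = near-cong Z Z (p + k) k λ x → periodic-shift per x k

  -- Vanishing of the part with T^N = -1.

  q : ℕ
  q = 6 + u + c

  2+h+q≡N : 2 + h + q ≡ N
  2+h+q≡N = lemma u c
    where
    lemma : ∀ u c → 2 + (8 + (u + c)) + (6 + u + c) ≡ 8 + (u + c) + (8 + (u + c))
    lemma = ℕ-Ring.solve-∀

  -- W = (1 - T^N) Z is the component to be killed, and q = h - 2. Being both N-periodic and
  -- N-antiperiodic, W satisfies 2W = 0.
  kernel⇒N-periodic : ∀ {Z} m → h ≡ m * 2 → Periodic n Z → (∀ k → rowS Z k ≡ 0ℤ) →
    Periodic N Z
  kernel⇒N-periodic {Z} m h≡m*2 per ker k = sym (ℤ.i-j≡0⇒i≡j _ _ (W≡0 k))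
    where
    W : ℕ → ℤ
    W k = Z k -ℤ Z (N + k)

    NN : ∀ x → Z (N + (N + x)) ≡ Z x
    NN x = trans (cong Z (sym (ℕ.+-assoc N N x))) (per x)

    W-antiperiodic : ∀ k → W (N + k) ≡ -ℤ W k
    W-antiperiodic k = trans (cong (λ z → Z (N + k) -ℤ z) (NN k)) (swap (Z (N + k)) (Z k))
      where
      swap : ∀ x y → x -ℤ y ≡ -ℤ (y -ℤ x)
      swap = ℤ-Ring.solve-∀

    shift-N : ∀ x k → Z (x + (N + (N + k))) ≡ Z (x + k)
    shift-N x k = trans (cong (λ y → Z (x + y)) (sym (ℕ.+-assoc N N k))) (periodic-shift per x k)

    swap-N : ∀ x k → Z (x + (N + k)) ≡ Z (N + (x + k))
    swap-N x k = cong Z (lemma x N k)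
      where
      lemma : ∀ x y k → x + (y + k) ≡ y + (x + k)
      lemma = ℕ-Ring.solve-∀

    -- Subtract the row at N + k from the row at k: the terms of `near` and of h occur in both and
    -- cancel.
    W-step : ∀ k → W (4 + (q + k)) ≡ W (q + k)
    W-step k = ℤ.i-j≡0⇒i≡j _ _ (begin
      W (4 + (q + k)) -ℤ W (q + k)
        ≡⟨ cancel (near Z k) (near Z (N + k)) (Z (h + k)) (Z (h + (N + k)))
             (Z (4 + (q + k))) (Z (N + (4 + (q + k)))) (Z (q + k)) (Z (N + (q + k))) ⟩
      (near Z k +ℤ Z (h + k) +ℤ Z (4 + (q + k)) +ℤ
        (near Z (N + k) +ℤ Z (h + (N + k)) +ℤ Z (N + (q + k)))) -ℤ
      (near Z (N + k) +ℤ Z (h + (N + k)) +ℤ Z (N + (4 + (q + k))) +ℤ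
        (near Z k +ℤ Z (h + k) +ℤ Z (q + k)))
        ≡⟨ cong₂ _-ℤ_
             (cong (λ z → near Z k +ℤ Z (h + k) +ℤ Z (4 + (q + k)) +ℤ
                (near Z (N + k) +ℤ Z (h + (N + k)) +ℤ z)) (sym (swap-N q k)))
             (cong₂ _+ℤ_
                (cong (λ z → near Z (N + k) +ℤ Z (h + (N + k)) +ℤ z) (sym (swap-N (4 + q) k)))
                (cong₂ _+ℤ_
                   (cong₂ _+ℤ_
                      (sym (near-cong Z Z (N + (N + k)) k (λ x → shift-N x k)))
                      (sym (shift-N h k)))
                   (sym (shift-N q k)))) ⟩
      (near Z k +ℤ Z (h + k) +ℤ Z (2 + h + k) +ℤ
        (near Z (N + k) +ℤ Z (h + (N + k)) +ℤ Z (q + (N + k)))) -ℤ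
      (near Z (N + k) +ℤ Z (h + (N + k)) +ℤ Z (2 + h + (N + k)) +ℤ
        (near Z (N + (N + k)) +ℤ Z (h + (N + (N + k))) +ℤ Z (q + (N + (N + k)))))
        ≡⟨ cong₂ _-ℤ_ (trans (sym (row-near Z k)) (ker k))
             (trans (sym (row-near Z (N + k))) (ker (N + k))) ⟩
      0ℤ ∎)
      where
      cancel : ∀ a b x y p p′ r r′ →
        (p -ℤ p′) -ℤ (r -ℤ r′) ≡
        (a +ℤ x +ℤ p +ℤ (b +ℤ y +ℤ r′)) -ℤ (b +ℤ y +ℤ p′ +ℤ (a +ℤ x +ℤ r))
      cancel = ℤ-Ring.solve-∀

    W-n-periodic : Periodic n W
    W-n-periodic k = trans (cong W (ℕ.+-assoc N N k))
      (trans (W-antiperiodic (N + k))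
        (trans (cong -ℤ_ (W-antiperiodic k)) (ℤ.neg-involutive (W k))))

    -- To undo the shift by q, move on by 2 + h + N, which completes q to the period n.
    W-4-periodic : Periodic 4 W
    W-4-periodic k = begin
      W (4 + k)                         ≡⟨ W-n-periodic (4 + k) ⟨
      W (n + (4 + k))                   ≡⟨ cong W (split N q (2 + h) k 2+h+q≡N) ⟩
      W (4 + (q + (2 + h + (N + k))))   ≡⟨ W-step (2 + h + (N + k)) ⟩
      W (q + (2 + h + (N + k)))         ≡⟨ cong W (join N q (2 + h) k 2+h+q≡N) ⟩
      W (n + k)                         ≡⟨ W-n-periodic k ⟩
      W k                               ∎
      where
      lemma₁ : ∀ N q r k → N + (r + q) + (4 + k) ≡ 4 + (q + (r + (N + k)))
      lemma₁ = ℕ-Ring.solve-∀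
      split : ∀ N q r k → r + q ≡ N → N + N + (4 + k) ≡ 4 + (q + (r + (N + k)))
      split N q r k e = trans (cong (λ x → N + x + (4 + k)) (sym e)) (lemma₁ N q r k)
      lemma₂ : ∀ N q r k → q + (r + (N + k)) ≡ N + (r + q) + k
      lemma₂ = ℕ-Ring.solve-∀
      join : ∀ N q r k → r + q ≡ N → q + (r + (N + k)) ≡ N + N + k
      join N q r k e = trans (lemma₂ N q r k) (cong (λ x → N + x + k) e)

    W-N-periodic : Periodic N W
    W-N-periodic k = trans (cong (λ x → W (x + k)) (trans (cong (λ x → x + x) h≡m*2) (four m)))
      (periodic-* W-4-periodic m k)
      where
      four : ∀ m → m * 2 + m * 2 ≡ m * 4
      four = ℕ-Ring.solve-∀

    W≡0 : ∀ k → W k ≡ 0ℤ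
    W≡0 k = ℤ.*-cancelˡ-≡ (+ 2) (W k) 0ℤ (begin
      + 2 *ℤ W k           ≡⟨ double (W k) ⟩
      W k -ℤ -ℤ W k        ≡⟨ cong (λ w → W k -ℤ w)
                                 (trans (sym (W-antiperiodic k)) (W-N-periodic k)) ⟩
      W k -ℤ W k           ≡⟨ ℤ.+-inverseʳ (W k) ⟩
      0ℤ                   ∎)
      where
      double : ∀ x → + 2 *ℤ x ≡ x -ℤ -ℤ x
      double = ℤ-Ring.solve-∀

  -- Descent for N-periodic null sequences.

  Harmonic : (ℕ → ℤ) → Set
  Harmonic Z = Periodic N Z × (∀ k → rowS Z k ≡ 0ℤ)

  row-N-periodic : ∀ {Z} → Periodic N Z → ∀ k → rowS Z k ≡
    near Z k +ℤ Z (h + k) +ℤ Z (2 + h + k) +ℤ (near Z k +ℤ Z (h + k) +ℤ Z (6 + u + c + k))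
  row-N-periodic {Z} per k = trans (row-near Z k)
    (cong (near Z k +ℤ Z (h + k) +ℤ Z (2 + h + k) +ℤ_)
      (cong₂ _+ℤ_ (cong₂ _+ℤ_ (near-periodic per k) (periodic-shift per h k))
        (periodic-shift per (6 + u + c) k)))

  -- With T^N = 1 the row equation is 2 near + 2T^h + T^(h + 2) + T^(h - 2) = 0. Multiplied by T^(h
  -- + 2) it becomes T⁴ + 2T² + 1 + 2T^(h + 2) near = 0; solving for (T⁴ - 1)/2 gives this C.
  halfStep : (ℕ → ℤ) → ℕ → ℤ
  halfStep Z k = -ℤ (Z k +ℤ Z (2 + k) +ℤ near Z (2 + h + k))

  harmonic-step : ∀ {Z} → Harmonic Z → ∀ k → Z (4 + k) ≡ Z k +ℤ + 2 *ℤ halfStep Z k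
  harmonic-step {Z} (per , ker) k = ℤ.i-j≡0⇒i≡j _ _ (begin
    Z (4 + k) -ℤ (Z k +ℤ + 2 *ℤ halfStep Z k)
      ≡⟨ regroup (near Z k′) (Z (2 + k)) (Z (4 + k)) (Z k) ⟩
    near Z k′ +ℤ Z (2 + k) +ℤ Z (4 + k) +ℤ (near Z k′ +ℤ Z (2 + k) +ℤ Z k)
      ≡⟨ cong₂ _+ℤ_
           (cong₂ _+ℤ_ (cong (near Z k′ +ℤ_) h+k′) 2+h+k′)
           (cong₂ _+ℤ_ (cong (near Z k′ +ℤ_) h+k′) q+k′) ⟩
    near Z k′ +ℤ Z (h + k′) +ℤ Z (2 + h + k′) +ℤ (near Z k′ +ℤ Z (h + k′) +ℤ Z (6 + u + c + k′))
      ≡⟨ row-N-periodic per k′ ⟨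
    rowS Z k′
      ≡⟨ ker k′ ⟩
    0ℤ ∎)
    where
    k′ : ℕ
    k′ = 2 + h + k
    regroup : ∀ a y x z → x -ℤ (z +ℤ + 2 *ℤ -ℤ (z +ℤ y +ℤ a)) ≡ a +ℤ y +ℤ x +ℤ (a +ℤ y +ℤ z)
    regroup = ℤ-Ring.solve-∀
    from-N : ∀ {x} y → N + (y + k) ≡ x → Z (y + k) ≡ Z x
    from-N y e = trans (sym (per (y + k))) (cong Z e)
    h+k′ : Z (2 + k) ≡ Z (h + k′)
    h+k′ = from-N 2 (lemma h k)
      where
      lemma : ∀ h k → h + h + (2 + k) ≡ h + (2 + h + k)
      lemma = ℕ-Ring.solve-∀
    2+h+k′ : Z (4 + k) ≡ Z (2 + h + k′)
    2+h+k′ = from-N 4 (lemma h k)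
      where
      lemma : ∀ h k → h + h + (4 + k) ≡ 2 + h + (2 + h + k)
      lemma = ℕ-Ring.solve-∀
    q+k′ : Z k ≡ Z (6 + u + c + k′)
    q+k′ = from-N 0 (lemma u c k)
      where
      lemma : ∀ u c k → let h = 8 + (u + c) in h + h + k ≡ 6 + u + c + (2 + h + k)
      lemma = ℕ-Ring.solve-∀

  row-lin : ∀ {x y z W Z Z′} → LinRel x y z W Z Z′ → ∀ k →
    x *ℤ rowS W k ≡ y *ℤ rowS Z k +ℤ z *ℤ rowS Z′ k
  row-lin {x} {y} {z} rel k = lin-+ {x} {y} {z}
    (segSum-lin {x} {y} {z} segs (λ d → rel (k + d)))
    (segSum-lin {x} {y} {z} segs (λ d → rel (k + (n ∸ d))))

  harmonic-lin : ∀ x y z .{{_ : NonZeroℤ x}} {W Z Z′} → LinRel x y z W Z Z′ →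
    Harmonic Z → Harmonic Z′ → Harmonic W
  harmonic-lin x y z {W} rel (perZ , kerZ) (perZ′ , kerZ′) =
    (λ k → ℤ.*-cancelˡ-≡ x _ _ (trans (rel (N + k))
      (trans (cong₂ (λ a b → y *ℤ a +ℤ z *ℤ b) (perZ k) (perZ′ k)) (sym (rel k))))) ,
    (λ k → ℤ.*-cancelˡ-≡ x _ _ (trans (row-lin {x} {y} {z} rel k)
      (trans (cong₂ (λ a b → y *ℤ a +ℤ z *ℤ b) (kerZ k) (kerZ′ k)) (sym (lin-0 x y z)))))

  harmonic-translate : ∀ {Z} s → Harmonic Z → Harmonic (λ k → Z (s + k))
  harmonic-translate {Z} s (per , ker) = periodic-translate per s , λ k →
    trans (cong₂ _+ℤ_ (segSum-cong segs λ d → cong Z (sym (ℕ.+-assoc s k d)))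
            (segSum-cong segs λ d → cong Z (sym (ℕ.+-assoc s k (n ∸ d)))))
      (ker (s + k))

  -- Twice `halfStep Z` is the difference of a translate of Z and Z, both harmonic, and the factor 2
  -- cancels; thus the window sums inside `near` need not be shown to commute with the row operator.
  harmonic-halfStep : ∀ {Z} → Harmonic Z → Harmonic (halfStep Z)
  harmonic-halfStep {Z} LZ = harmonic-lin (+ 2) (+ 1) (-ℤ (+ 1))
    (λ k → trans (isolate (Z k) (halfStep Z k))
      (cong (λ x → + 1 *ℤ x +ℤ -ℤ (+ 1) *ℤ Z k) (sym (harmonic-step LZ k))))
    (harmonic-translate 4 LZ) LZ
    where
    isolate : ∀ x y → + 2 *ℤ y ≡ + 1 *ℤ (x +ℤ + 2 *ℤ y) +ℤ -ℤ (+ 1) *ℤ x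
    isolate = ℤ-Ring.solve-∀

  harmonic⇒8-periodic : ∀ {Z} b → Harmonic Z → (∀ k → ∣ Z k ∣ ≤ b) → Periodic 8 Z
  harmonic⇒8-periodic b = descent Harmonic halfStep _ proj₁ harmonic-halfStep
    (λ {Z} {W} LZ LW → harmonic-lin (+ 1) (+ 1) (+ 1) (λ k → expand (Z k) (W k)) LZ LW)
    harmonic-step b
    where
    expand : ∀ x y → + 1 *ℤ (x +ℤ y) ≡ + 1 *ℤ x +ℤ + 1 *ℤ y
    expand = ℤ-Ring.solve-∀

  -- The row equation multiplied by T - 1.

  -- Both runs telescope, and the adjacent pairs t - 1, t and N - t, N - t + 1 each lose their
  -- common term. The far run ends at N, so its last term is `Z k`. Eight terms remain, whatever u
  -- and c are.
  near-difference : ∀ {Z} → Periodic N Z → ∀ k → near Z (1 + k) -ℤ near Z k ≡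
    Z (2 + (u + k)) -ℤ Z (1 + k) +ℤ (Z (5 + (u + k)) -ℤ Z (3 + (u + k))) +ℤ
    (Z (6 + (c + h + k)) -ℤ Z (4 + (c + h + k))) +ℤ (Z k -ℤ Z (7 + (c + h + k)))
  near-difference {Z} per k = begin
    near Z (1 + k) -ℤ near Z k
      ≡⟨ cong (_-ℤ near Z k) (near-parts
           {p₁ = window Z (2 + k) (1 + u)} refl
           (push 3 u k) (push 4 u k) (push (4 + c) h k) (push (5 + c) h k)
           (cong (λ a → window Z a (1 + u)) (push′ (7 + c) h k))) ⟩
    window Z (2 + k) (1 + u) +ℤ Z (4 + (u + k)) +ℤ Z (5 + (u + k)) +ℤ
      Z (5 + (c + h + k)) +ℤ Z (6 + (c + h + k)) +ℤ window Z (8 + c + h + k) (1 + u)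
      -ℤ near Z k
      ≡⟨ regroup (window Z (2 + k) (1 + u)) (Z (4 + (u + k))) (Z (5 + (u + k)))
           (Z (5 + (c + h + k))) (Z (6 + (c + h + k))) (window Z (8 + c + h + k) (1 + u))
           (window Z (1 + k) (1 + u)) (Z (3 + (u + k)))
           (Z (4 + (c + h + k))) (window Z (7 + c + h + k) (1 + u)) ⟩
    window Z (2 + k) (1 + u) -ℤ window Z (1 + k) (1 + u) +ℤ (Z (5 + (u + k)) -ℤ Z (3 + (u + k))) +ℤ
    (Z (6 + (c + h + k)) -ℤ Z (4 + (c + h + k))) +ℤ
    (window Z (8 + c + h + k) (1 + u) -ℤ window Z (7 + c + h + k) (1 + u))
      ≡⟨ cong₂ (λ x y → x +ℤ (Z (5 + (u + k)) -ℤ Z (3 + (u + k))) +ℤ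
           (Z (6 + (c + h + k)) -ℤ Z (4 + (c + h + k))) +ℤ y)
           (trans (window-telescope Z (1 + k) (1 + u))
             (cong (λ x → Z x -ℤ Z (1 + k)) (end₁ u k)))
           (trans (window-telescope Z (7 + c + h + k) (1 + u))
             (cong (_-ℤ Z (7 + c + h + k)) (trans (cong Z (end₇ u c k)) (per k)))) ⟩
    Z (2 + (u + k)) -ℤ Z (1 + k) +ℤ (Z (5 + (u + k)) -ℤ Z (3 + (u + k))) +ℤ
    (Z (6 + (c + h + k)) -ℤ Z (4 + (c + h + k))) +ℤ (Z k -ℤ Z (7 + (c + h + k))) ∎
    where
    push′ : ∀ a b k → a + b + (1 + k) ≡ 1 + a + b + k
    push′ = ℕ-Ring.solve-∀
    push : ∀ a b k → Z (a + b + (1 + k)) ≡ Z (1 + a + b + k)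
    push a b k = cong Z (push′ a b k)
    end₁ : ∀ u k → 1 + k + (1 + u) ≡ 2 + (u + k)
    end₁ = ℕ-Ring.solve-∀
    end₇ : ∀ u c k → let h = 8 + (u + c) in 7 + c + h + k + (1 + u) ≡ h + h + k
    end₇ = ℕ-Ring.solve-∀
    regroup : ∀ a b d e f g a′ b′ e′ g′ →
      a +ℤ b +ℤ d +ℤ e +ℤ f +ℤ g -ℤ (a′ +ℤ b′ +ℤ b +ℤ e′ +ℤ e +ℤ g′) ≡
      a -ℤ a′ +ℤ (d -ℤ b′) +ℤ (f -ℤ e′) +ℤ (g -ℤ g′)
    regroup = ℤ-Ring.solve-∀

  -- T - 1 is applied to T⁴ + 2T² + 1 + 2T^(h + 2) near = 0; the three shift hypotheses then replace
  -- the exponents u, N - t and h by r, r′ and s.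
  differencedRow-vanishes : ∀ {Z r r′ s} → Harmonic Z → Shift u r Z →
    Shift (4 + (c + h)) r′ Z → Shift h s Z → ∀ k → eval (differencedRow r r′ s) Z k ≡ 0ℤ
  differencedRow-vanishes {Z} {r} {r′} {s} LZ@(per , _) sh-u sh-a sh-h k = begin
    eval (differencedRow r r′ s) Z k
      ≡⟨ regroup (Z (5 + k)) (Z (4 + k)) (Z (3 + k)) (Z (2 + k)) (Z (1 + k)) (Z k)
           (Z (4 + r + s + k)) (Z (3 + s + k)) (Z (7 + r + s + k)) (Z (5 + r + s + k))
           (Z (4 + r′ + s + k)) (Z (2 + r′ + s + k)) (Z (2 + s + k)) (Z (5 + r′ + s + k)) ⟩
    Z (5 + k) -ℤ Z (4 + k) +ℤ + 2 *ℤ (Z (3 + k) -ℤ Z (2 + k)) +ℤ (Z (1 + k) -ℤ Z k) +ℤ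
    + 2 *ℤ (Z (4 + r + s + k) -ℤ Z (3 + s + k) +ℤ (Z (7 + r + s + k) -ℤ Z (5 + r + s + k)) +ℤ
      (Z (4 + r′ + s + k) -ℤ Z (2 + r′ + s + k)) +ℤ (Z (2 + s + k) -ℤ Z (5 + r′ + s + k)))
      ≡⟨ cong (λ x → Z (5 + k) -ℤ Z (4 + k) +ℤ + 2 *ℤ (Z (3 + k) -ℤ Z (2 + k)) +ℤ
           (Z (1 + k) -ℤ Z k) +ℤ + 2 *ℤ x) (sym near-reduced) ⟩
    Z (5 + k) -ℤ Z (4 + k) +ℤ + 2 *ℤ (Z (3 + k) -ℤ Z (2 + k)) +ℤ (Z (1 + k) -ℤ Z k) +ℤ
    + 2 *ℤ (near Z (1 + k′) -ℤ near Z k′)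
      ≡⟨ cong₂ (λ x y → x -ℤ y +ℤ + 2 *ℤ (Z (3 + k) -ℤ Z (2 + k)) +ℤ (Z (1 + k) -ℤ Z k) +ℤ
           + 2 *ℤ (near Z (1 + k′) -ℤ near Z k′))
           (trans (harmonic-step LZ (1 + k))
             (cong (λ j → Z (1 + k) +ℤ + 2 *ℤ -ℤ (Z (1 + k) +ℤ Z (3 + k) +ℤ near Z j))
               (ℕ.+-suc (2 + h) k)))
           (harmonic-step LZ k) ⟩
    Z (1 + k) +ℤ + 2 *ℤ -ℤ (Z (1 + k) +ℤ Z (3 + k) +ℤ near Z (1 + k′)) -ℤ
      (Z k +ℤ + 2 *ℤ -ℤ (Z k +ℤ Z (2 + k) +ℤ near Z k′)) +ℤ
      + 2 *ℤ (Z (3 + k) -ℤ Z (2 + k)) +ℤ (Z (1 + k) -ℤ Z k) +ℤ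
      + 2 *ℤ (near Z (1 + k′) -ℤ near Z k′)
      ≡⟨ cancel (Z k) (Z (1 + k)) (Z (2 + k)) (Z (3 + k)) (near Z k′) (near Z (1 + k′)) ⟩
    0ℤ ∎
    where
    k′ : ℕ
    k′ = 2 + h + k
    regroup : ∀ z₅ z₄ z₃ z₂ z₁ z₀ a b d e f g i j →
      + 1 *ℤ z₅ +ℤ (-ℤ (+ 1) *ℤ z₄ +ℤ (+ 2 *ℤ z₃ +ℤ (-ℤ (+ 2) *ℤ z₂ +ℤ
        (+ 1 *ℤ z₁ +ℤ (-ℤ (+ 1) *ℤ z₀ +ℤ (+ 2 *ℤ a +ℤ (-ℤ (+ 2) *ℤ b +ℤ (+ 2 *ℤ d +ℤ
        (-ℤ (+ 2) *ℤ e +ℤ (+ 2 *ℤ f +ℤ (-ℤ (+ 2) *ℤ g +ℤ (+ 2 *ℤ i +ℤ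
        (-ℤ (+ 2) *ℤ j +ℤ 0ℤ)))))))))))))
      ≡ z₅ -ℤ z₄ +ℤ + 2 *ℤ (z₃ -ℤ z₂) +ℤ (z₁ -ℤ z₀) +ℤ
        + 2 *ℤ (a -ℤ b +ℤ (d -ℤ e) +ℤ (f -ℤ g) +ℤ (i -ℤ j))
    regroup = ℤ-Ring.solve-∀
    cancel : ∀ z₀ z₁ z₂ z₃ w w′ →
      z₁ +ℤ + 2 *ℤ -ℤ (z₁ +ℤ z₃ +ℤ w′) -ℤ (z₀ +ℤ + 2 *ℤ -ℤ (z₀ +ℤ z₂ +ℤ w)) +ℤ
      + 2 *ℤ (z₃ -ℤ z₂) +ℤ (z₁ -ℤ z₀) +ℤ + 2 *ℤ (w′ -ℤ w) ≡ 0ℤ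
    cancel = ℤ-Ring.solve-∀
    at-h : ∀ x → Z (x + k′) ≡ Z (2 + x + s + k)
    at-h x = trans (cong Z (pull x h k)) (trans (shift-under h s Z sh-h (2 + x) k)
      (cong Z (sym (ℕ.+-assoc (2 + x) s k))))
      where
      pull : ∀ x h k → x + (2 + h + k) ≡ 2 + x + (h + k)
      pull = ℕ-Ring.solve-∀
    at-u : ∀ x → Z (x + (u + k′)) ≡ Z (2 + x + r + s + k)
    at-u x = trans (shift-under u r Z sh-u x k′)
      (trans (cong Z (sym (ℕ.+-assoc x r k′))) (at-h (x + r)))
    at-a : ∀ x → Z (4 + x + (c + h + k′)) ≡ Z (2 + x + r′ + s + k)
    at-a x = trans (cong Z (pull x (c + h) k′)) (trans (shift-under (4 + (c + h)) r′ Z sh-a x k′)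
      (trans (cong Z (sym (ℕ.+-assoc x r′ k′))) (at-h (x + r′))))
      where
      pull : ∀ x a k → 4 + x + (a + k) ≡ x + (4 + a + k)
      pull = ℕ-Ring.solve-∀
    near-reduced : near Z (1 + k′) -ℤ near Z k′ ≡
      Z (4 + r + s + k) -ℤ Z (3 + s + k) +ℤ (Z (7 + r + s + k) -ℤ Z (5 + r + s + k)) +ℤ
      (Z (4 + r′ + s + k) -ℤ Z (2 + r′ + s + k)) +ℤ (Z (2 + s + k) -ℤ Z (5 + r′ + s + k))
    near-reduced = trans (near-difference per k′)
      (cong₂ _+ℤ_ (cong₂ _+ℤ_ (cong₂ _+ℤ_
        (cong₂ _-ℤ_ (at-u 2) (at-h 1))
        (cong₂ _-ℤ_ (at-u 5) (at-u 3)))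
        (cong₂ _-ℤ_ (at-a 2) (at-a 0)))
        (cong₂ _-ℤ_ (at-h 0) (at-a 3)))

-- Null sequences for even t and 8 dividing n.

-- Here t = 4 + 2v. As 8 divides n = 4h, both h and u are even, and so is the slack c = 2e.
module _ (v e : ℕ) where
  open Graph (v * 2) (e * 2)
  open ≡-Reasoning

  h-even : h ≡ (4 + (v + e)) * 2
  h-even = lemma v e
    where
    lemma : ∀ v e → 8 + (v * 2 + e * 2) ≡ (4 + (v + e)) * 2
    lemma = ℕ-Ring.solve-∀

  kernel⇒2-periodic : ∀ {Z} → Periodic n Z → (∀ k → rowS Z k ≡ 0ℤ) → Periodic 2 Z
  kernel⇒2-periodic {Z} per ker =
    differencedRow⇒2-periodic w x per₈
      (differencedRow-vanishes {r′ = 12 ∸ r} harmonic shift-u shift-a shift-h)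
    where
    harmonic : Harmonic Z
    harmonic = kernel⇒N-periodic (4 + (v + e)) h-even per ker , ker
    per₈ : Periodic 8 Z
    per₈ = let b , Z≤b = periodic⇒bounded per in harmonic⇒8-periodic b harmonic Z≤b
    w x : Fin 4
    w = proj₁ (even-residue per₈ v)
    x = proj₁ (even-residue per₈ (4 + (v + e)))
    r : ℕ
    r = toℕ w * 2
    shift-u : Shift (v * 2) r Z
    shift-u = proj₂ (even-residue per₈ v)
    shift-h : Shift h (toℕ x * 2) Z
    shift-h k = trans (cong (λ j → Z (j + k)) h-even) (proj₂ (even-residue per₈ (4 + (v + e))) k)
    r≤12 : r ≤ 12
    r≤12 = ℕ.≤-trans (ℕ.*-monoˡ-≤ 2 (Fin.toℕ≤pred[n] w)) (ℕ.m≤m+n 6 6)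
    -- Adding 16 = 4 + r + r′ to the exponent and trading r for u completes a = N - t to N and
    -- leaves r′.
    shift-a : Shift (4 + (e * 2 + h)) (12 ∸ r) Z
    shift-a k = begin
      Z (a + k)                      ≡⟨ periodic-* per₈ 2 (a + k) ⟨
      Z (4 + 12 + (a + k))           ≡⟨ cong (λ j → Z (4 + j + (a + k))) (ℕ.m+[n∸m]≡n r≤12) ⟨
      Z (4 + (r + r′) + (a + k))     ≡⟨ cong Z (regroup r r′ a k) ⟩
      Z (r + (4 + (a + (r′ + k))))   ≡⟨ shift-u (4 + (a + (r′ + k))) ⟨
      Z (v * 2 + (4 + (a + (r′ + k)))) ≡⟨ cong Z (fold (v * 2) (e * 2) (r′ + k)) ⟩
      Z (N + (r′ + k))               ≡⟨ proj₁ harmonic (r′ + k) ⟩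
      Z (r′ + k)                     ∎
      where
      a r′ : ℕ
      a = 4 + (e * 2 + h)
      r′ = 12 ∸ r
      regroup : ∀ r r′ a k → 4 + (r + r′) + (a + k) ≡ r + (4 + (a + (r′ + k)))
      regroup = ℕ-Ring.solve-∀
      fold : ∀ u c m → let h = 8 + (u + c) in u + (4 + (4 + (c + h) + m)) ≡ h + h + m
      fold = ℕ-Ring.solve-∀

  -- Parity count: `near` has 4 + 2v odd and 2 + 2v even generators, and the even numbers h and h +
  -- 2 restore the balance. So `S′` has t generators of each parity, each occurring with both signs,
  -- and 8 + 4v = 2t.
  row-2-periodic : ∀ {Z} → Periodic 2 Z → ∀ k →
    rowS Z k ≡ + (8 + 4 * v) *ℤ (Z k +ℤ Z (1 + k))
  row-2-periodic {Z} per k = begin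
    rowS Z k
      ≡⟨ row-N-periodic per-N k ⟩
    near Z k +ℤ Z (h + k) +ℤ Z (2 + h + k) +ℤ (near Z k +ℤ Z (h + k) +ℤ Z (6 + v * 2 + e * 2 + k))
      ≡⟨ cong₂ _+ℤ_ (cong₂ _+ℤ_ (cong₂ _+ℤ_ near-value at-h) (trans (per (h + k)) at-h))
           (cong₂ _+ℤ_ (cong₂ _+ℤ_ near-value at-h)
             (parity (3 + (v + e)) 0 (6 + v * 2 + e * 2) (q-even v e) k)) ⟩
    half (+ v) z y +ℤ z +ℤ z +ℤ (half (+ v) z y +ℤ z +ℤ z)
      ≡⟨ collect (+ v) z y ⟩
    (+ 8 +ℤ + 4 *ℤ + v) *ℤ (z +ℤ y)
      ≡⟨ cong (λ x → (+ 8 +ℤ x) *ℤ (z +ℤ y)) (ℤ.pos-* 4 v) ⟨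
    + (8 + 4 * v) *ℤ (z +ℤ y) ∎
    where
    z y : ℤ
    z = Z k
    y = Z (1 + k)
    half : ℤ → ℤ → ℤ → ℤ
    half v z y =
      y +ℤ v *ℤ (z +ℤ y) +ℤ y +ℤ z +ℤ z +ℤ y +ℤ (y +ℤ v *ℤ (z +ℤ y))
    collect : ∀ v z y →
      y +ℤ v *ℤ (z +ℤ y) +ℤ y +ℤ z +ℤ z +ℤ y +ℤ (y +ℤ v *ℤ (z +ℤ y)) +ℤ z +ℤ z +ℤ
      (y +ℤ v *ℤ (z +ℤ y) +ℤ y +ℤ z +ℤ z +ℤ y +ℤ (y +ℤ v *ℤ (z +ℤ y)) +ℤ z +ℤ z) ≡
      (+ 8 +ℤ + 4 *ℤ v) *ℤ (z +ℤ y)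
    collect = ℤ-Ring.solve-∀
    per-N : Periodic N Z
    per-N k = trans (cong (λ x → Z (x + k))
      (trans (cong (λ x → x + x) h-even) (double (4 + (v + e)))))
      (periodic-* per ((4 + (v + e)) * 2) k)
      where
      double : ∀ m → m * 2 + m * 2 ≡ m * 2 * 2
      double = ℕ-Ring.solve-∀
    parity : ∀ j r x → x ≡ j * 2 + r → ∀ k → Z (x + k) ≡ Z (r + k)
    parity j r x refl k = trans (cong Z (ℕ.+-assoc (j * 2) r k)) (periodic-* per j (r + k))
    at-h : Z (h + k) ≡ z
    at-h = parity (4 + (v + e)) 0 h (trans h-even (sym (ℕ.+-identityʳ _))) k
    q-even : ∀ v e → 6 + v * 2 + e * 2 ≡ (3 + (v + e)) * 2 + 0
    q-even = ℕ-Ring.solve-∀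
    p₃ : ∀ v → 3 + v * 2 ≡ (1 + v) * 2 + 1
    p₃ = ℕ-Ring.solve-∀
    p₄ : ∀ v → 4 + v * 2 ≡ (2 + v) * 2 + 0
    p₄ = ℕ-Ring.solve-∀
    a₄ : ∀ v e → 4 + e * 2 + (8 + (v * 2 + e * 2)) ≡ (6 + (v + e + e)) * 2 + 0
    a₄ = ℕ-Ring.solve-∀
    a₅ : ∀ v e → 5 + e * 2 + (8 + (v * 2 + e * 2)) ≡ (6 + (v + e + e)) * 2 + 1
    a₅ = ℕ-Ring.solve-∀
    a₇ : ∀ v e → 7 + e * 2 + (8 + (v * 2 + e * 2)) ≡ (7 + (v + e + e)) * 2 + 1
    a₇ = ℕ-Ring.solve-∀
    odd-window : window Z (1 + k) (1 + v * 2) ≡ y +ℤ + v *ℤ (z +ℤ y)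
    odd-window = cong (y +ℤ_) (trans (window-2-periodic per (2 + k) v)
      (cong₂ (λ a b → + v *ℤ (a +ℤ b)) (per k) (per (1 + k))))
    far-window : window Z (7 + e * 2 + h + k) (1 + v * 2) ≡ y +ℤ + v *ℤ (z +ℤ y)
    far-window = trans (window-cong {Z} {Z} (7 + e * 2 + h + k) (1 + k) (1 + v * 2) λ j _ →
      trans (cong Z (ℕ.+-assoc (7 + e * 2 + h) k j))
        (parity (7 + (v + e + e)) 1 (7 + e * 2 + h) (a₇ v e) (k + j)))
      odd-window
    near-value : near Z k ≡ half (+ v) z y
    near-value = near-parts odd-window
      (parity (1 + v) 1 (3 + v * 2) (p₃ v) k) (parity (2 + v) 0 (4 + v * 2) (p₄ v) k)
      (parity (6 + (v + e + e)) 0 (4 + e * 2 + h) (a₄ v e) k)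
      (parity (6 + (v + e + e)) 1 (5 + e * 2 + h) (a₅ v e) k) far-window

  kernel⇒alternating : ∀ {Z} → Periodic n Z → (∀ k → rowS Z k ≡ 0ℤ) → ∀ k → Z (1 + k) ≡ -ℤ Z k
  kernel⇒alternating {Z} per ker k = begin
    Z (1 + k)                  ≡⟨ isolate (Z k) (Z (1 + k)) ⟩
    Z k +ℤ Z (1 + k) -ℤ Z k    ≡⟨ cong (_-ℤ Z k) sum≡0 ⟩
    0ℤ -ℤ Z k                  ≡⟨ ℤ.+-identityˡ _ ⟩
    -ℤ Z k                     ∎
    where
    isolate : ∀ x y → y ≡ x +ℤ y -ℤ x
    isolate = ℤ-Ring.solve-∀
    sum≡0 : Z k +ℤ Z (1 + k) ≡ 0ℤ
    sum≡0 = ℤ.*-cancelˡ-≡ (+ (8 + 4 * v)) _ 0ℤ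
      (trans (sym (row-2-periodic (kernel⇒2-periodic per ker) k))
        (trans (ker k) (sym (ℤ.*-zeroʳ (+ (8 + 4 * v))))))

  -- Regularity and the null space over the rationals.

  matrix-row : ∀ {Z} → Periodic n Z → ∀ i →
    sumFin n (λ j → adjMatrix n (S′ t n) i j *ℚ fromℤ (Z (toℕ j))) ≡ fromℤ (rowS Z (toℕ i))
  matrix-row {Z} per i = trans
    (sumFin-window n (λ j → gate (circAdjℕ n (S′ t n) (toℕ i) j) (Z j)) 0
      λ j → adjMatrix-fromℤ n (S′ t n) i j (Z (toℕ j)))
    (cong fromℤ (row-sum S′-tiles ℕ.≤-refl Z per (Fin.toℕ<n i)))

  regular : IsRegular n (S′ t n) (4 * t)
  regular i = ℤ.+-injective (begin
    + degree n (S′ t n) i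
      ≡⟨ count-window (circAdj n (S′ t n) i) (circAdjℕ n (S′ t n) (toℕ i))
           (λ j → j) 0 (λ _ → refl) ⟩
    window (λ j → gate (circAdjℕ n (S′ t n) (toℕ i) j) (+ 1)) 0 n
      ≡⟨ row-sum S′-tiles ℕ.≤-refl (λ _ → + 1) (λ _ → refl) (Fin.toℕ<n i) ⟩
    rowS (λ _ → + 1) (toℕ i)
      -- A constant sequence is 2-periodic, so the degree is 2t · 2.
      ≡⟨ row-2-periodic {λ _ → + 1} (λ _ → refl) (toℕ i) ⟩
    + (8 + 4 * v) *ℤ + 2
      ≡⟨ ℤ.pos-* (8 + 4 * v) 2 ⟨
    + ((8 + 4 * v) * 2)
      ≡⟨ cong +_ (double v) ⟩
    + (4 * t) ∎)
    where
    double : ∀ v → (8 + 4 * v) * 2 ≡ 4 * (4 + v * 2)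
    double = ℕ-Ring.solve-∀

  nullVector : Fin n → ℚ
  nullVector i = fromℤ (alternating (toℕ i))

  nullVector≢0 : ∀ i → nullVector i ≢ 0ℚ
  nullVector≢0 i eq = alternating≢0 (toℕ i) (fromℤ-injective eq)

  alternating-n-periodic : Periodic n alternating
  alternating-n-periodic k = trans (cong (λ x → alternating (x + k)) n-even)
    (periodic-* {2} {alternating} alternating-2-periodic (4 * (4 + (v + e))) k)
    where
    lemma : ∀ m → m * 2 + m * 2 + (m * 2 + m * 2) ≡ 4 * m * 2
    lemma = ℕ-Ring.solve-∀
    n-even : n ≡ 4 * (4 + (v + e)) * 2
    n-even = trans (cong (λ x → x + x + (x + x)) h-even) (lemma (4 + (v + e)))

  nullVector-kernel : InKernel n (adjMatrix n (S′ t n)) nullVector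
  nullVector-kernel i = trans (matrix-row alternating-n-periodic i) (cong fromℤ (begin
    rowS alternating k
      ≡⟨ row-2-periodic alternating-2-periodic k ⟩
    + (8 + 4 * v) *ℤ (alternating k -ℤ alternating k)
      ≡⟨ cong (+ (8 + 4 * v) *ℤ_) (ℤ.+-inverseʳ (alternating k)) ⟩
    + (8 + 4 * v) *ℤ 0ℤ
      ≡⟨ ℤ.*-zeroʳ (+ (8 + 4 * v)) ⟩
    0ℤ ∎))
    where
    k : ℕ
    k = toℕ i

  row-n-periodic : ∀ {Z} → Periodic n Z → Periodic n (rowS Z)
  row-n-periodic {Z} per k = cong₂ _+ℤ_ (segSum-cong segs slide)
    (segSum-cong segs λ d → slide (n ∸ d))
    where
    slide : ∀ d → Z (n + k + d) ≡ Z (k + d)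
    slide d = trans (cong Z (ℕ.+-assoc n k d)) (per (k + d))

  kernel-multiple : ∀ y → InKernel n (adjMatrix n (S′ t n)) y →
    ∃ λ c → ∀ i → y i ≡ c *ℚ nullVector i
  kernel-multiple y y-kernel with clear-denominators y
  -- The factor is the entry of y at 0, because `alternating 0` is 1; the equation is proved after
  -- scaling by the common denominator D.
  ... | d , z , dy≡z = y Fin.zero , λ i → *-cancelˡ D (begin
    D *ℚ y i
      ≡⟨ dy≡Z i ⟩
    fromℤ (Z (toℕ i))
      ≡⟨ cong fromℤ (alternating-multiple Z
           (kernel⇒alternating (extend-periodic z) Z-kernel) (toℕ i)) ⟩
    fromℤ (alternating (toℕ i) *ℤ Z 0)
      ≡⟨ fromℤ-* (alternating (toℕ i)) (Z 0) ⟩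
    nullVector i *ℚ fromℤ (Z 0)
      ≡⟨ cong (nullVector i *ℚ_) (dy≡Z Fin.zero) ⟨
    nullVector i *ℚ (D *ℚ y Fin.zero)
      ≡⟨ swapℚ (nullVector i) D (y Fin.zero) ⟩
    D *ℚ (nullVector i *ℚ y Fin.zero)
      ≡⟨ cong (D *ℚ_) (ℚ.*-comm (nullVector i) (y Fin.zero)) ⟩
    D *ℚ (y Fin.zero *ℚ nullVector i) ∎)
    where
    D : ℚ
    D = fromℤ (+ suc d)
    Z : ℕ → ℤ
    Z = extend z
    dy≡Z : ∀ i → D *ℚ y i ≡ fromℤ (Z (toℕ i))
    dy≡Z i = trans (dy≡z i) (cong fromℤ (sym (extend-toℕ z i)))
    A : Fin n → Fin n → ℚ
    A = adjMatrix n (S′ t n)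
    Z-kernel-Fin : ∀ i → rowS Z (toℕ i) ≡ 0ℤ
    Z-kernel-Fin i = fromℤ-injective (begin
      fromℤ (rowS Z (toℕ i))
        ≡⟨ matrix-row (extend-periodic z) i ⟨
      sumFin n (λ j → A i j *ℚ fromℤ (Z (toℕ j)))
        ≡⟨ sumFin-cong n (λ j → trans (cong (A i j *ℚ_) (sym (dy≡Z j))) (swapℚ (A i j) D (y j))) ⟩
      sumFin n (λ j → D *ℚ (A i j *ℚ y j))
        ≡⟨ sumFin-*ˡ n D (λ j → A i j *ℚ y j) ⟩
      D *ℚ sumFin n (λ j → A i j *ℚ y j)
        ≡⟨ cong (D *ℚ_) (y-kernel i) ⟩
      D *ℚ 0ℚ
        ≡⟨ ℚ.*-zeroʳ D ⟩
      0ℚ ∎)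
    Z-kernel : ∀ k → rowS Z k ≡ 0ℤ
    Z-kernel k = trans (periodic-% (row-n-periodic (extend-periodic z)) k)
      (trans (cong (rowS Z) (sym (Fin.toℕ-fromℕ< (m%n<n k n)))) (Z-kernel-Fin (k mod n)))

  nut : IsNutCirc n (S′ t n)
  nut = s≤s (s≤s z≤n) , nullVector ,
    ((Fin.zero , nullVector≢0 Fin.zero) , nullVector-kernel , kernel-multiple) , nullVector≢0

theorem4p1 : (t n : ℕ) → 2 ∣ t → 4 ≤ t → 4 * t + 16 ≤ n → 8 ∣ n →
    IsRegular n (S′ t n) (4 * t) × IsNutCirc n (S′ t n)
theorem4p1 t n (divides 0 refl) () _ _
theorem4p1 t n (divides 1 refl) (s≤s (s≤s ())) _ _
theorem4p1 t n (divides (suc (suc v)) refl) _ 4t+16≤n (divides k refl) =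
  subst (λ n → IsRegular n (S′ t n) (4 * t) × IsNutCirc n (S′ t n)) order
    (regular v e , nut v e)
  where
  -- For t = 4 + 2v and n = 8k, the bound 4t + 16 ≤ n says 4 + v ≤ k, and e measures the slack.
  e : ℕ
  e = k ∸ (4 + v)
  4+v≤k : 4 + v ≤ k
  4+v≤k = ℕ.*-cancelʳ-≤ (4 + v) k 8 (ℕ.≤-trans (ℕ.≤-reflexive (eight v)) 4t+16≤n)
    where
    eight : ∀ v → (4 + v) * 8 ≡ 4 * (4 + v * 2) + 16
    eight = ℕ-Ring.solve-∀
  order : Graph.n (v * 2) (e * 2) ≡ k * 8
  order = trans (lemma v e) (cong (_* 8) (ℕ.m+[n∸m]≡n 4+v≤k))
    where
    lemma : ∀ v e → let h = 8 + (v * 2 + e * 2) in h + h + (h + h) ≡ (4 + v + e) * 8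
    lemma = ℕ-Ring.solve-∀
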